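{- Let $\frac13\leq p\leq\frac12$. If $\mathcal F_1,\mathcal F_2,\mathcal F_3\subset 2^{[n]}$ are non-empty $3$-cross intersecting families, then $$\mu_p(\mathcal F_1)+\mu_p(\mathcal F_2)+\mu_p(\mathcal F_3)\leq 3p.$$ Suppose, moreover, that $\frac13<p\leq\frac12$, that all $\mathcal F_i$ ($i=1,2,3$) are shifted, and that $\bigcap F=\emptyset$, where the intersection is taken over all $F\in\mathcal F_1\cup\mathcal F_2\cup\mathcal F_3$. Then $$\mu_p(\mathcal F_1)+\mu_p(\mathcal F_2)+\mu_p(\mathcal F_3)\leq 3p-\epsilon_p,$$ where $\epsilon_p=(2-3p)(3p-1)$.
   Context: Let $n\ge1$, $[n]=\{1,2,\ldots,n\}$, and let $2^{[n]}$ be its power set. For $0<p<1$, $q=1-p$, the $p$-measure of a family $\mathcal G\subset 2^{[n]}$ is $\mu_p(\mathcal G)=\sum_{G\in\mathcal G}p^{|G|}q^{n-|G|}$. Families $\mathcal F_1,\mathcal F_2,\mathcal F_3\subset 2^{[n]}$ are $3$-cross intersecting if $F_1\cap F_2\cap F_3\neq\emptyset$ for all $F_1\in\mathcal F_1$, $F_2\in\mathcal F_2$, $F_3\in\mathcal F_3$; they are non-empty $3$-cross intersecting if moreover $\mathcal F_i\neq\emptyset$ for every $i=1,2,3$. A family $\mathcal F\subset 2^{[n]}$ is shifted if, whenever $F\in\mathcal F$ and $1\leq i<j\leq n$ satisfy $F\cap\{i,j\}=\{j\}$, then $(F\setminus\{j\})\cup\{i\}\in\mathcal F$. -}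

module Defs where

open import Data.Bool using (Bool; T; _∨_)
open import Data.Fin using (Fin)
import Data.Fin as Fin
open import Data.Fin.Subset
  using (Subset; inside; outside; ∣_∣; _∩_; _∪_; _─_; ⁅_⁆; ⋂; Nonempty)
open import Data.Integer using (+_)
open import Data.List using (List; []; _∷_; _++_; map; foldr; filterᵇ)
open import Data.Nat using (ℕ; zero; suc; _∸_; _⊔_)
import Data.Nat as ℕ
import Data.Nat.Properties as ℕ
open import Data.Product using (Σ-syntax; ∃-syntax; _×_; _,_)
open import Data.Rational using (ℚ; 0ℚ; 1ℚ; ½; Positive; positive)
import Data.Rational as ℚ
import Data.Rational.Properties as ℚ
open import Data.Rational.Solver using (module +-*-Solver)
import Data.Vec as Vec
open import Relation.Binary.PropositionalEquality
  using (_≡_; refl; sym; trans; cong; subst)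

-- Cauchy sequences of rationals.  The relations _≤ᴿ_ and _<ᴿ_ below do not
-- distinguish sequences with the same limit, so no quotient is taken.

IsCauchy : (ℕ → ℚ) → Set
IsCauchy s = ∀ ε → 0ℚ ℚ.< ε →
  ∃[ N ] (∀ j k → N ℕ.≤ j → N ℕ.≤ k → ℚ.∣ s j ℚ.- s k ∣ ℚ.≤ ε)

record ℝ : Set where
  constructor mkℝ
  field
    seq    : ℕ → ℚ
    cauchy : IsCauchy seq

open ℝ public

infix 4 _≤ᴿ_ _<ᴿ_

_≤ᴿ_ : ℝ → ℝ → Set
x ≤ᴿ y = ∀ ε → 0ℚ ℚ.< ε →
  ∃[ N ] (∀ k → N ℕ.≤ k → seq x k ℚ.≤ seq y k ℚ.+ ε)

_<ᴿ_ : ℝ → ℝ → Set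
x <ᴿ y = Σ[ ε ∈ ℚ ] (0ℚ ℚ.< ε ×
  ∃[ N ] (∀ k → N ℕ.≤ k → seq x k ℚ.+ ε ℚ.≤ seq y k))

private
  half-pos : ∀ {ε} → 0ℚ ℚ.< ε → 0ℚ ℚ.< ½ ℚ.* ε
  half-pos {ε} 0<ε =
    ℚ.positive⁻¹ (½ ℚ.* ε) {{ℚ.pos*pos⇒pos ½ ε {{positive 0<ε}}}}

  half+half : ∀ ε → ½ ℚ.* ε ℚ.+ ½ ℚ.* ε ≡ ε
  half+half ε = trans (sym (ℚ.*-distribʳ-+ ε ½ ½)) (ℚ.*-identityˡ ε)

  const-cauchy : ∀ r → IsCauchy (λ _ → r)
  const-cauchy r ε 0<ε = 0 , λ _ _ _ _ →
    subst (ℚ._≤ ε) (sym (cong ℚ.∣_∣ (ℚ.+-inverseʳ r))) (ℚ.<⇒≤ 0<ε)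

  +-cauchy : ∀ {s t} → IsCauchy s → IsCauchy t → IsCauchy (λ k → s k ℚ.+ t k)
  +-cauchy {s} {t} cs ct ε 0<ε =
    let (M , hM) = cs (½ ℚ.* ε) (half-pos 0<ε)
        (N , hN) = ct (½ ℚ.* ε) (half-pos 0<ε)
    in M ⊔ N , λ j k j≥ k≥ → begin
      ℚ.∣ (s j ℚ.+ t j) ℚ.- (s k ℚ.+ t k) ∣
        ≡⟨ cong ℚ.∣_∣ (rearrange (s j) (t j) (s k) (t k)) ⟩
      ℚ.∣ (s j ℚ.- s k) ℚ.+ (t j ℚ.- t k) ∣
        ≤⟨ ℚ.∣p+q∣≤∣p∣+∣q∣ (s j ℚ.- s k) (t j ℚ.- t k) ⟩
      ℚ.∣ s j ℚ.- s k ∣ ℚ.+ ℚ.∣ t j ℚ.- t k ∣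
        ≤⟨ ℚ.+-mono-≤ (hM j k (ℕ.m⊔n≤o⇒m≤o M N j≥) (ℕ.m⊔n≤o⇒m≤o M N k≥))
                      (hN j k (ℕ.m⊔n≤o⇒n≤o M N j≥) (ℕ.m⊔n≤o⇒n≤o M N k≥)) ⟩
      ½ ℚ.* ε ℚ.+ ½ ℚ.* ε
        ≡⟨ half+half ε ⟩
      ε ∎
    where
    open ℚ.≤-Reasoning
    rearrange : ∀ a b c d →
      (a ℚ.+ b) ℚ.- (c ℚ.+ d) ≡ (a ℚ.- c) ℚ.+ (b ℚ.- d)
    rearrange = solve 4 (λ a b c d →
      (a :+ b) :- (c :+ d) := (a :- c) :+ (b :- d)) refl
      where open +-*-Solver

  neg-cauchy : ∀ {s} → IsCauchy s → IsCauchy (λ k → ℚ.- s k)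
  neg-cauchy {s} cs ε 0<ε =
    let (N , h) = cs ε 0<ε
    in N , λ j k j≥ k≥ → subst (ℚ._≤ ε)
      (trans (sym (ℚ.∣-p∣≡∣p∣ (s j ℚ.- s k)))
             (cong ℚ.∣_∣ (ℚ.neg-distrib-+ (s j) (ℚ.- s k))))
      (h j k j≥ k≥)

  eventually-bounded : ∀ {s} → IsCauchy s →
    Σ[ B ∈ ℚ ] (Positive B × ∃[ N ] (∀ k → N ℕ.≤ k → ℚ.∣ s k ∣ ℚ.≤ B))
  eventually-bounded {s} cs =
    let (N , h) = cs 1ℚ (ℚ.positive⁻¹ 1ℚ)
    in ℚ.∣ s N ∣ ℚ.+ 1ℚ
     , ℚ.nonNeg+pos⇒pos ℚ.∣ s N ∣ {{ℚ.nonNegative (ℚ.0≤∣p∣ (s N))}} 1ℚ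
     , N
     , λ k k≥ → begin
      ℚ.∣ s k ∣
        ≡⟨ cong ℚ.∣_∣ (split (s k) (s N)) ⟩
      ℚ.∣ s N ℚ.+ (s k ℚ.- s N) ∣
        ≤⟨ ℚ.∣p+q∣≤∣p∣+∣q∣ (s N) (s k ℚ.- s N) ⟩
      ℚ.∣ s N ∣ ℚ.+ ℚ.∣ s k ℚ.- s N ∣
        ≤⟨ ℚ.+-monoʳ-≤ ℚ.∣ s N ∣ (h k N k≥ ℕ.≤-refl) ⟩
      ℚ.∣ s N ∣ ℚ.+ 1ℚ ∎
    where
    open ℚ.≤-Reasoning
    split : ∀ a b → a ≡ b ℚ.+ (a ℚ.- b)
    split = solve 2 (λ a b → a := b :+ (a :- b)) refl
      where open +-*-Solver

  ∣*∣-mono : ∀ {a b A B} → ℚ.∣ a ∣ ℚ.≤ A → ℚ.∣ b ∣ ℚ.≤ B → ℚ.∣ a ℚ.* b ∣ ℚ.≤ A ℚ.* B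
  ∣*∣-mono {a} {b} {A} {B} a≤ b≤ = begin
    ℚ.∣ a ℚ.* b ∣
      ≡⟨ ℚ.∣p*q∣≡∣p∣*∣q∣ a b ⟩
    ℚ.∣ a ∣ ℚ.* ℚ.∣ b ∣
      ≤⟨ ℚ.*-monoʳ-≤-nonNeg ℚ.∣ b ∣ {{ℚ.nonNegative (ℚ.0≤∣p∣ b)}} a≤ ⟩
    A ℚ.* ℚ.∣ b ∣
      ≤⟨ ℚ.*-monoˡ-≤-nonNeg A {{ℚ.nonNegative (ℚ.≤-trans (ℚ.0≤∣p∣ a) a≤)}} b≤ ⟩
    A ℚ.* B ∎
    where open ℚ.≤-Reasoning

  scale : ∀ ε C → 0ℚ ℚ.< ε → Positive C → Σ[ δ ∈ ℚ ] (0ℚ ℚ.< δ × C ℚ.* δ ≡ ε)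
  scale ε C 0<ε C>0 = r ℚ.* ε
    , ℚ.positive⁻¹ (r ℚ.* ε)
        {{ℚ.pos*pos⇒pos r {{ℚ.1/pos⇒pos C {{C>0}}}} ε {{positive 0<ε}}}}
    , trans (sym (ℚ.*-assoc C r ε))
        (trans (cong (ℚ._* ε) (ℚ.*-inverseʳ C {{C≢0}})) (ℚ.*-identityˡ ε))
    where
    C≢0 : ℚ.NonZero C
    C≢0 = ℚ.pos⇒nonZero C {{C>0}}
    r : ℚ
    r = ℚ.1/_ C {{C≢0}}

  *-cauchy : ∀ {s t} → IsCauchy s → IsCauchy t → IsCauchy (λ k → s k ℚ.* t k)
  *-cauchy {s} {t} cs ct ε 0<ε =
    let (A , A>0 , K , hA) = eventually-bounded cs
        (B , B>0 , L , hB) = eventually-bounded ct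
        (δ , 0<δ , δ-eq) = scale ε (A ℚ.+ B) 0<ε (ℚ.pos+pos⇒pos A {{A>0}} B {{B>0}})
        (M , hM) = cs δ 0<δ
        (N , hN) = ct δ 0<δ
        K≤ : ∀ {j} → (K ⊔ L) ⊔ (M ⊔ N) ℕ.≤ j → K ℕ.≤ j
        K≤ j≥ = ℕ.m⊔n≤o⇒m≤o K L (ℕ.m⊔n≤o⇒m≤o (K ⊔ L) (M ⊔ N) j≥)
        L≤ : ∀ {j} → (K ⊔ L) ⊔ (M ⊔ N) ℕ.≤ j → L ℕ.≤ j
        L≤ j≥ = ℕ.m⊔n≤o⇒n≤o K L (ℕ.m⊔n≤o⇒m≤o (K ⊔ L) (M ⊔ N) j≥)
        M≤ : ∀ {j} → (K ⊔ L) ⊔ (M ⊔ N) ℕ.≤ j → M ℕ.≤ j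
        M≤ j≥ = ℕ.m⊔n≤o⇒m≤o M N (ℕ.m⊔n≤o⇒n≤o (K ⊔ L) (M ⊔ N) j≥)
        N≤ : ∀ {j} → (K ⊔ L) ⊔ (M ⊔ N) ℕ.≤ j → N ℕ.≤ j
        N≤ j≥ = ℕ.m⊔n≤o⇒n≤o M N (ℕ.m⊔n≤o⇒n≤o (K ⊔ L) (M ⊔ N) j≥)
    in (K ⊔ L) ⊔ (M ⊔ N) , λ j k j≥ k≥ → begin
      ℚ.∣ s j ℚ.* t j ℚ.- s k ℚ.* t k ∣
        ≡⟨ cong ℚ.∣_∣ (rearrange (s j) (t j) (s k) (t k)) ⟩
      ℚ.∣ s j ℚ.* (t j ℚ.- t k) ℚ.+ t k ℚ.* (s j ℚ.- s k) ∣
        ≤⟨ ℚ.∣p+q∣≤∣p∣+∣q∣ (s j ℚ.* (t j ℚ.- t k)) (t k ℚ.* (s j ℚ.- s k)) ⟩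
      ℚ.∣ s j ℚ.* (t j ℚ.- t k) ∣ ℚ.+ ℚ.∣ t k ℚ.* (s j ℚ.- s k) ∣
        ≤⟨ ℚ.+-mono-≤
             (∣*∣-mono {s j} {t j ℚ.- t k}
               (hA j (K≤ j≥)) (hN j k (N≤ j≥) (N≤ k≥)))
             (∣*∣-mono {t k} {s j ℚ.- s k}
               (hB k (L≤ k≥)) (hM j k (M≤ j≥) (M≤ k≥))) ⟩
      A ℚ.* δ ℚ.+ B ℚ.* δ
        ≡⟨ sym (ℚ.*-distribʳ-+ δ A B) ⟩
      (A ℚ.+ B) ℚ.* δ
        ≡⟨ δ-eq ⟩
      ε ∎
    where
    open ℚ.≤-Reasoning
    rearrange : ∀ a b c d →
      a ℚ.* b ℚ.- c ℚ.* d ≡ a ℚ.* (b ℚ.- d) ℚ.+ d ℚ.* (a ℚ.- c)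
    rearrange = solve 4 (λ a b c d →
      a :* b :- c :* d := a :* (b :- d) :+ d :* (a :- c)) refl
      where open +-*-Solver

infixl 6 _+ᴿ_ _-ᴿ_
infixl 7 _*ᴿ_
infixr 8 _^ᴿ_

fromℚ : ℚ → ℝ
fromℚ r = mkℝ (λ _ → r) (const-cauchy r)

0ᴿ 1ᴿ : ℝ
0ᴿ = fromℚ 0ℚ
1ᴿ = fromℚ 1ℚ

_+ᴿ_ : ℝ → ℝ → ℝ
x +ᴿ y = mkℝ (λ k → seq x k ℚ.+ seq y k)
             (+-cauchy {seq x} {seq y} (cauchy x) (cauchy y))

_-ᴿ_ : ℝ → ℝ → ℝ
x -ᴿ y = mkℝ (λ k → seq x k ℚ.- seq y k)
             (+-cauchy {seq x} (cauchy x) (neg-cauchy {seq y} (cauchy y)))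

_*ᴿ_ : ℝ → ℝ → ℝ
x *ᴿ y = mkℝ (λ k → seq x k ℚ.* seq y k)
             (*-cauchy {seq x} {seq y} (cauchy x) (cauchy y))

_^ᴿ_ : ℝ → ℕ → ℝ
x ^ᴿ zero  = 1ᴿ
x ^ᴿ suc k = x *ᴿ x ^ᴿ k

∑ᴿ : List ℝ → ℝ
∑ᴿ = foldr _+ᴿ_ 0ᴿ

Family : ℕ → Set
Family n = Subset n → Bool

infix 4 _∈ᶠ_
infixl 6 _∪ᶠ_

_∈ᶠ_ : ∀ {n} → Subset n → Family n → Set
G ∈ᶠ 𝓖 = T (𝓖 G)

_∪ᶠ_ : ∀ {n} → Family n → Family n → Family n
(𝓕 ∪ᶠ 𝓖) G = 𝓕 G ∨ 𝓖 G

allSubsets : ∀ n → List (Subset n)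
allSubsets zero    = Vec.[] ∷ []
allSubsets (suc n) =
  map (Vec._∷_ outside) (allSubsets n) ++ map (Vec._∷_ inside) (allSubsets n)

members : ∀ {n} → Family n → List (Subset n)
members {n} 𝓖 = filterᵇ 𝓖 (allSubsets n)

⋂ᶠ : ∀ {n} → Family n → Subset n
⋂ᶠ 𝓖 = ⋂ (members 𝓖)

weight : ∀ {n} → ℝ → Subset n → ℝ
weight {n} p G = p ^ᴿ ∣ G ∣ *ᴿ (1ᴿ -ᴿ p) ^ᴿ (n ∸ ∣ G ∣)

μ : ∀ {n} → ℝ → Family n → ℝ
μ p 𝓖 = ∑ᴿ (map (weight p) (members 𝓖))

NonemptyFamily : ∀ {n} → Family n → Set
NonemptyFamily 𝓖 = ∃[ G ] G ∈ᶠ 𝓖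

CrossIntersecting₃ : ∀ {n} → Family n → Family n → Family n → Set
CrossIntersecting₃ 𝓕₁ 𝓕₂ 𝓕₃ = ∀ F₁ F₂ F₃ →
  F₁ ∈ᶠ 𝓕₁ → F₂ ∈ᶠ 𝓕₂ → F₃ ∈ᶠ 𝓕₃ → Nonempty (F₁ ∩ F₂ ∩ F₃)

NonemptyCrossIntersecting₃ : ∀ {n} → Family n → Family n → Family n → Set
NonemptyCrossIntersecting₃ 𝓕₁ 𝓕₂ 𝓕₃ =
  NonemptyFamily 𝓕₁ × NonemptyFamily 𝓕₂ × NonemptyFamily 𝓕₃ ×
  CrossIntersecting₃ 𝓕₁ 𝓕₂ 𝓕₃

Shifted : ∀ {n} → Family n → Set
Shifted {n} 𝓕 = ∀ F (i j : Fin n) → F ∈ᶠ 𝓕 → i Fin.< j →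
  F ∩ (⁅ i ⁆ ∪ ⁅ j ⁆) ≡ ⁅ j ⁆ → (F ─ ⁅ j ⁆) ∪ ⁅ i ⁆ ∈ᶠ 𝓕

ε : ℝ → ℝ
ε p = (fromℚ (+ 2 ℚ./ 1) -ᴿ fromℚ (+ 3 ℚ./ 1) *ᴿ p)
      *ᴿ (fromℚ (+ 3 ℚ./ 1) *ᴿ p -ᴿ 1ᴿ)

-- Induction on n, splitting off the first point.  Write 𝓕⁰ and 𝓕¹ for the
-- sections of 𝓕 without and with that point, 𝓕⁺ = 𝓕⁰ ∪ 𝓕¹, x = μ 𝓕⁰ and
-- y = μ 𝓕⁺, so that x ≤ y and μ 𝓕 ≤ (1 − p) x + p y.  If 𝓕₁⁰ is non-empty, then
-- 𝓕₁⁰, 𝓕₂⁺, 𝓕₃⁺ are again non-empty cross intersecting, whence x₁ + y₂ + y₃ ≤ c for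
-- the bound c in question.  If at most one 𝓕ᵢ⁰ is empty, the average of the
-- available inequalities of this kind gives the bound c itself, since p ≤ 1/2.
-- If only 𝓕₃⁰ is non-empty, one gets p c + (1 − 2p) m + p for any m ≥ x₃, and
-- this is at most 3p for c = 3p, m = 1, as p ≥ 1/3.  If all 𝓕ᵢ⁰ are empty, the
-- bound 3p is trivial.
--
-- For shifted families the same induction with c = 3p − ε proves that either
-- the bound c holds or all members contain the first point.  The second
-- alternative cannot occur for a triple containing 𝓕⁺ with 𝓕⁰ non-empty, because
-- shifting the second point to the first puts a set without the second point
-- into 𝓕¹.  So it only arises when a single 𝓕₃⁰ is non-empty, and then m = p.

module Submission where

open import Data.Bool using (Bool; true; false; T; if_then_else_)
open import Data.Bool.Properties using (T-∨; T?)
open import Data.Empty as Empty using (⊥-elim)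
open import Data.Fin using (zero; suc)
open import Data.Fin.Subset
  using (Subset; inside; outside; ∣_∣; _∩_; ⋂; Nonempty; ⊥; _∈_)
open import Data.Fin.Subset.Properties
  using (∩-comm; ∩-assoc; x∈p∩q⁺; ∣p∣≤n; ∈⊤; ∉⊥; ∪-idem; ∩-zeroʳ)
open import Data.Integer using (+_)
open import Data.List using (List; []; _∷_; _++_; map; filterᵇ)
open import Data.List.Properties using (filter-++; map-++)
open import Data.List.Relation.Unary.All as All using (All; []; _∷_)
open import Data.List.Relation.Unary.All.Properties using (all-filter)
open import Data.Nat using (ℕ; zero; suc; _∸_; _⊔_; NonZero)
import Data.Nat as ℕ
import Data.Nat.Properties as ℕ
open import Data.Product using (Σ-syntax; ∃-syntax; _×_; _,_)
open import Data.Rational using (ℚ; 0ℚ; 1ℚ; _/_)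
import Data.Rational as ℚ
import Data.Rational.Properties as ℚ
open import Data.Rational.Solver using (module +-*-Solver)
open import Data.Sum using (_⊎_; inj₁; inj₂; [_,_])
import Data.Vec as Vec
open import Function using (_∘_; id)
open import Function.Bundles using (module Equivalence)
open import Relation.Binary.PropositionalEquality
  using (_≡_; refl; sym; trans; cong; cong₂; subst)
open import Relation.Nullary using (¬_; yes; no)
open import Defs
open +-*-Solver using (solve; con; _:=_; _:+_; _:*_; _:-_)

private
  variable
    n : ℕ

-- Ordered ring structure of the Cauchy reals

Eventually : (ℕ → Set) → Set
Eventually P = ∃[ N ] (∀ k → N ℕ.≤ k → P k)

eventually-× : ∀ {P Q : ℕ → Set} →
  Eventually P → Eventually Q → Eventually (λ k → P k × Q k)
eventually-× (M , f) (N , g) = M ⊔ N , λ k le →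
  f k (ℕ.m⊔n≤o⇒m≤o M N le) , g k (ℕ.m⊔n≤o⇒n≤o M N le)

eventually-map : ∀ {P Q : ℕ → Set} →
  (∀ k → P k → Q k) → Eventually P → Eventually Q
eventually-map h (N , f) = N , λ k le → h k (f k le)

0≤p+q : ∀ {p q} → 0ℚ ℚ.≤ p → 0ℚ ℚ.≤ q → 0ℚ ℚ.≤ p ℚ.+ q
0≤p+q = ℚ.+-mono-≤

0≤p*q : ∀ {p q} → 0ℚ ℚ.≤ p → 0ℚ ℚ.≤ q → 0ℚ ℚ.≤ p ℚ.* q
0≤p*q {p} {q} 0≤p 0≤q = ℚ.nonNegative⁻¹ (p ℚ.* q)
  {{ℚ.nonNeg*nonNeg⇒nonNeg p {{ℚ.nonNegative 0≤p}} q {{ℚ.nonNegative 0≤q}}}}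

0≤q-p : ∀ {p q} → p ℚ.≤ q → 0ℚ ℚ.≤ q ℚ.- p
0≤q-p {p} {q} p≤q =
  subst (ℚ._≤ q ℚ.- p) (ℚ.+-inverseʳ p) (ℚ.+-monoˡ-≤ (ℚ.- p) p≤q)

-- Needed for products in `0⊑x*y`. Taking `B` nonnegative makes A + B + 1 positive there, hence
-- invertible.
eventually-bounded-above : ∀ x →
  Σ[ B ∈ ℚ ] (0ℚ ℚ.≤ B × Eventually (λ k → seq x k ℚ.≤ B))
eventually-bounded-above x =
  let (N , h) = cauchy x 1ℚ (ℚ.positive⁻¹ 1ℚ)
      B = ℚ.∣ seq x N ∣ ℚ.+ 1ℚ
  in B
   , 0≤p+q (ℚ.0≤∣p∣ (seq x N)) (ℚ.<⇒≤ (ℚ.positive⁻¹ 1ℚ))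
   , N
   , λ k le → begin
      seq x k
        ≡⟨ split (seq x k) (seq x N) ⟩
      seq x N ℚ.+ (seq x k ℚ.- seq x N)
        ≤⟨ ℚ.+-mono-≤ (p≤∣p∣ (seq x N))
             (ℚ.≤-trans (p≤∣p∣ (seq x k ℚ.- seq x N)) (h k N le ℕ.≤-refl)) ⟩
      B ∎
  where
  open ℚ.≤-Reasoning
  p≤∣p∣ : ∀ p → p ℚ.≤ ℚ.∣ p ∣
  p≤∣p∣ p with ℚ.≤-total 0ℚ p
  ... | inj₁ 0≤p = ℚ.≤-reflexive (sym (ℚ.0≤p⇒∣p∣≡p 0≤p))
  ... | inj₂ p≤0 = ℚ.≤-trans p≤0 (ℚ.0≤∣p∣ p)
  split : ∀ a b → a ≡ b ℚ.+ (a ℚ.- b)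
  split = solve 2 (λ a b → a := b :+ (a :- b)) refl

infix 4 _⊑_

-- A record, so that Agda can infer x and y from the relation.
record _⊑_ (x y : ℝ) : Set where
  constructor ⟨_⟩
  field ⊑⇒≤ : x ≤ᴿ y

open _⊑_

-- Most inequalities below are certified this way: `z` is built from sums and products of
-- nonnegative reals, and the remaining identity is rational algebra at each index. The slack
-- allowed for `z` becomes the slack for `x`.
⊑-from-gap : ∀ {x y z} → 0ᴿ ⊑ z →
  (∀ k → seq y k ≡ seq x k ℚ.+ seq z k) → x ⊑ y
⊑-from-gap {x} {y} {z} ⟨ 0≤z ⟩ y≡x+z = ⟨ (λ δ 0<δ → eventually-map
  (λ k h → begin
    seq x k
      ≡⟨ ℚ.+-identityʳ (seq x k) ⟨
    seq x k ℚ.+ 0ℚ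
      ≤⟨ ℚ.+-monoʳ-≤ (seq x k) h ⟩
    seq x k ℚ.+ (seq z k ℚ.+ δ)
      ≡⟨ ℚ.+-assoc (seq x k) (seq z k) δ ⟨
    (seq x k ℚ.+ seq z k) ℚ.+ δ
      ≡⟨ cong (ℚ._+ δ) (y≡x+z k) ⟨
    seq y k ℚ.+ δ ∎) (0≤z δ 0<δ)) ⟩
  where open ℚ.≤-Reasoning

0⊑y-x : ∀ {x y} → x ⊑ y → 0ᴿ ⊑ y -ᴿ x
0⊑y-x {x} {y} ⟨ x≤y ⟩ = ⟨ (λ δ 0<δ → eventually-map
  (λ k h → subst (0ℚ ℚ.≤_) (rearrange (seq x k) (seq y k) δ) (0≤q-p h))
  (x≤y δ 0<δ)) ⟩
  where
  rearrange : ∀ a b δ → (b ℚ.+ δ) ℚ.- a ≡ (b ℚ.- a) ℚ.+ δ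
  rearrange = solve 3 (λ a b δ → (b :+ δ) :- a := (b :- a) :+ δ) refl

0⊑x+y : ∀ {x y} → 0ᴿ ⊑ x → 0ᴿ ⊑ y → 0ᴿ ⊑ x +ᴿ y
0⊑x+y {x} {y} ⟨ 0≤x ⟩ ⟨ 0≤y ⟩ = ⟨ (λ δ 0<δ →
  let 0<½δ = ℚ.positive⁻¹ (ℚ.½ ℚ.* δ)
               {{ℚ.pos*pos⇒pos ℚ.½ δ {{ℚ.positive 0<δ}}}}
  in eventually-map
    (λ k (h , h′) → subst (0ℚ ℚ.≤_) (rearrange (seq x k) (seq y k) δ) (0≤p+q h h′))
    (eventually-× (0≤x _ 0<½δ) (0≤y _ 0<½δ))) ⟩
  where
  rearrange : ∀ a b δ →
    (a ℚ.+ ℚ.½ ℚ.* δ) ℚ.+ (b ℚ.+ ℚ.½ ℚ.* δ) ≡ (a ℚ.+ b) ℚ.+ δ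
  rearrange = solve 3 (λ a b δ →
    (a :+ con ℚ.½ :* δ) :+ (b :+ con ℚ.½ :* δ) := (a :+ b) :+ δ) refl

-- Choose the smaller of 1 and η / C. Having δ ≤ 1 lets the constant `C` be fixed before δ.
small-δ : ∀ C η → ℚ.Positive C → 0ℚ ℚ.< η →
  Σ[ δ ∈ ℚ ] (0ℚ ℚ.< δ × δ ℚ.≤ 1ℚ × C ℚ.* δ ℚ.≤ η)
small-δ C η C>0 0<η = choose (ℚ.≤-total 1ℚ (r ℚ.* η))
  where
  instance
    C-nonZero : ℚ.NonZero C
    C-nonZero = ℚ.pos⇒nonZero C {{C>0}}
  r : ℚ
  r = ℚ.1/ C
  0<rη : 0ℚ ℚ.< r ℚ.* η
  0<rη = ℚ.positive⁻¹ (r ℚ.* η)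
    {{ℚ.pos*pos⇒pos r {{ℚ.1/pos⇒pos C {{C>0}}}} η {{ℚ.positive 0<η}}}}
  Crη≡η : C ℚ.* (r ℚ.* η) ≡ η
  Crη≡η = trans (sym (ℚ.*-assoc C r η))
    (trans (cong (ℚ._* η) (ℚ.*-inverseʳ C)) (ℚ.*-identityˡ η))
  choose : 1ℚ ℚ.≤ r ℚ.* η ⊎ r ℚ.* η ℚ.≤ 1ℚ →
    Σ[ δ ∈ ℚ ] (0ℚ ℚ.< δ × δ ℚ.≤ 1ℚ × C ℚ.* δ ℚ.≤ η)
  choose (inj₁ 1≤rη) = 1ℚ , ℚ.positive⁻¹ 1ℚ , ℚ.≤-refl ,
    subst (C ℚ.* 1ℚ ℚ.≤_) Crη≡η
      (ℚ.*-monoˡ-≤-nonNeg C {{ℚ.pos⇒nonNeg C {{C>0}}}} 1≤rη)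
  choose (inj₂ rη≤1) = r ℚ.* η , 0<rη , rη≤1 , ℚ.≤-reflexive Crη≡η

-- The slack of a b is (a + δ)(b + δ) − δ (a + b + δ), with a + b + δ ≤ A + B + 1.
0≤ab+η : ∀ {a b A B δ η} → a ℚ.≤ A → b ℚ.≤ B →
  0ℚ ℚ.≤ a ℚ.+ δ → 0ℚ ℚ.≤ b ℚ.+ δ → 0ℚ ℚ.< δ → δ ℚ.≤ 1ℚ →
  ((A ℚ.+ B) ℚ.+ 1ℚ) ℚ.* δ ℚ.≤ η → 0ℚ ℚ.≤ a ℚ.* b ℚ.+ η
0≤ab+η {a} {b} {A} {B} {δ} {η} a≤A b≤B 0≤a+δ 0≤b+δ 0<δ δ≤1 Cδ≤η =
  subst (0ℚ ℚ.≤_) (rearrange a b A B δ η)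
    (0≤p+q (0≤p+q (0≤p*q 0≤a+δ 0≤b+δ)
      (0≤p*q (ℚ.<⇒≤ 0<δ) (0≤p+q (0≤p+q (0≤q-p a≤A) (0≤q-p b≤B)) (0≤q-p δ≤1))))
      (0≤q-p Cδ≤η))
  where
  rearrange : ∀ a b A B δ η →
    (a ℚ.+ δ) ℚ.* (b ℚ.+ δ)
      ℚ.+ δ ℚ.* (((A ℚ.- a) ℚ.+ (B ℚ.- b)) ℚ.+ (1ℚ ℚ.- δ))
      ℚ.+ (η ℚ.- ((A ℚ.+ B) ℚ.+ 1ℚ) ℚ.* δ) ≡ a ℚ.* b ℚ.+ η
  rearrange = solve 6 (λ a b A B δ η →
    (a :+ δ) :* (b :+ δ)
      :+ δ :* (((A :- a) :+ (B :- b)) :+ (con 1ℚ :- δ))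
      :+ (η :- ((A :+ B) :+ con 1ℚ) :* δ) := a :* b :+ η) refl

-- The terms of a nonnegative real may be slightly negative, so upper bounds on both factors are
-- used to control the error of the product.
0⊑x*y : ∀ {x y} → 0ᴿ ⊑ x → 0ᴿ ⊑ y → 0ᴿ ⊑ x *ᴿ y
0⊑x*y {x} {y} ⟨ 0≤x ⟩ ⟨ 0≤y ⟩ = ⟨ (λ η 0<η → bound η 0<η
    (eventually-bounded-above x) (eventually-bounded-above y)) ⟩
  where
  bound : ∀ η → 0ℚ ℚ.< η →
    Σ[ A ∈ ℚ ] (0ℚ ℚ.≤ A × Eventually (λ k → seq x k ℚ.≤ A)) →
    Σ[ B ∈ ℚ ] (0ℚ ℚ.≤ B × Eventually (λ k → seq y k ℚ.≤ B)) →
    Eventually (λ k → 0ℚ ℚ.≤ seq x k ℚ.* seq y k ℚ.+ η)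
  bound η 0<η (A , 0≤A , x≤A) (B , 0≤B , y≤B)
    with small-δ ((A ℚ.+ B) ℚ.+ 1ℚ) η
           (ℚ.nonNeg+pos⇒pos (A ℚ.+ B) {{ℚ.nonNegative (0≤p+q 0≤A 0≤B)}} 1ℚ) 0<η
  ... | δ , 0<δ , δ≤1 , Cδ≤η = eventually-map
    (λ k ((a≤A , b≤B) , (0≤a+δ , 0≤b+δ)) →
      0≤ab+η a≤A b≤B 0≤a+δ 0≤b+δ 0<δ δ≤1 Cδ≤η)
    (eventually-× (eventually-× x≤A y≤B) (eventually-× (0≤x δ 0<δ) (0≤y δ 0<δ)))

0⊑const : ∀ r → 0ℚ ℚ.≤ r → 0ᴿ ⊑ fromℚ r
0⊑const r 0≤r = ⟨ (λ δ 0<δ → 0 , λ _ _ → 0≤p+q 0≤r (ℚ.<⇒≤ 0<δ)) ⟩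

infix 4 _≈_

-- Propositional equality on `ℝ` would also compare the Cauchy proofs. The recursion for the measure
-- holds at every index, so equality of the sequences suffices.
record _≈_ (x y : ℝ) : Set where
  constructor ⟨_⟩
  field pointwise : ∀ k → seq x k ≡ seq y k

open _≈_

≈-refl : ∀ {x} → x ≈ x
≈-refl = ⟨ (λ _ → refl) ⟩

≈-sym : ∀ {x y} → x ≈ y → y ≈ x
≈-sym ⟨ x≈y ⟩ = ⟨ (λ k → sym (x≈y k)) ⟩

≈-trans : ∀ {x y z} → x ≈ y → y ≈ z → x ≈ z
≈-trans ⟨ x≈y ⟩ ⟨ y≈z ⟩ = ⟨ (λ k → trans (x≈y k) (y≈z k)) ⟩

+ᴿ-cong : ∀ x y u v → x ≈ y → u ≈ v → x +ᴿ u ≈ y +ᴿ v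
+ᴿ-cong _ _ _ _ ⟨ x≈y ⟩ ⟨ u≈v ⟩ = ⟨ (λ k → cong₂ ℚ._+_ (x≈y k) (u≈v k)) ⟩

⊑-reflexive : ∀ {x y} → x ≈ y → x ⊑ y
⊑-reflexive {x} ⟨ x≈y ⟩ = ⊑-from-gap (0⊑const 0ℚ ℚ.≤-refl)
  λ k → trans (sym (x≈y k)) (sym (ℚ.+-identityʳ (seq x k)))

⊑-trans : ∀ {x y z} → x ⊑ y → y ⊑ z → x ⊑ z
⊑-trans {x} {y} {z} x⊑y y⊑z =
  ⊑-from-gap (0⊑x+y (0⊑y-x x⊑y) (0⊑y-x y⊑z))
    λ k → identity (seq x k) (seq y k) (seq z k)
  where
  identity : ∀ a b c → c ≡ a ℚ.+ ((b ℚ.- a) ℚ.+ (c ℚ.- b))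
  identity = solve 3 (λ a b c → c := a :+ ((b :- a) :+ (c :- b))) refl

-- Sections along the first point

infixl 9 _⁰ _¹ _⁺

_⁰ _¹ _⁺ : Family (suc n) → Family n
(𝓕 ⁰) G = 𝓕 (outside Vec.∷ G)
(𝓕 ¹) G = 𝓕 (inside Vec.∷ G)
𝓕 ⁺ = 𝓕 ⁰ ∪ᶠ 𝓕 ¹

∈-∪ᶠˡ : ∀ (𝓕 𝓖 : Family n) {G} → G ∈ᶠ 𝓕 → G ∈ᶠ 𝓕 ∪ᶠ 𝓖
∈-∪ᶠˡ _ _ = Equivalence.from T-∨ ∘ inj₁

∈-∪ᶠʳ : ∀ (𝓕 𝓖 : Family n) {G} → G ∈ᶠ 𝓖 → G ∈ᶠ 𝓕 ∪ᶠ 𝓖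
∈-∪ᶠʳ 𝓕 _ {G} = Equivalence.from (T-∨ {𝓕 G}) ∘ inj₂

∈-∪ᶠ⁻ : ∀ (𝓕 𝓖 : Family n) {G} → G ∈ᶠ 𝓕 ∪ᶠ 𝓖 → G ∈ᶠ 𝓕 ⊎ G ∈ᶠ 𝓖
∈-∪ᶠ⁻ _ _ = Equivalence.to T-∨

Vacant : Family n → Set
Vacant 𝓕 = ∀ G → ¬ (G ∈ᶠ 𝓕)

-- The case split is constructive: membership is Boolean, and recursion on the two sections searches
-- all subsets.
vacant? : ∀ {n} (𝓕 : Family n) → Vacant 𝓕 ⊎ NonemptyFamily 𝓕
vacant? {zero} 𝓕 with T? (𝓕 Vec.[])
... | yes []∈𝓕 = inj₂ (Vec.[] , []∈𝓕)
... | no []∉𝓕 = inj₁ λ { Vec.[] → []∉𝓕 }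
vacant? {suc n} 𝓕 with vacant? (𝓕 ⁰) | vacant? (𝓕 ¹)
... | inj₂ (G , G∈) | _ = inj₂ (outside Vec.∷ G , G∈)
... | inj₁ _ | inj₂ (G , G∈) = inj₂ (inside Vec.∷ G , G∈)
... | inj₁ v⁰ | inj₁ v¹ = inj₁ λ
  { (outside Vec.∷ G) → v⁰ G ; (inside Vec.∷ G) → v¹ G }

-- Vacancy of 𝓕 ⁰ says that every member contains the first point.
Star : Family n → Set
Star {zero} _ = Empty.⊥
Star {suc n} 𝓕 = Vacant (𝓕 ⁰)

-- The p-measure

∑ᴿ-++ : ∀ xs ys → ∑ᴿ (xs ++ ys) ≈ ∑ᴿ xs +ᴿ ∑ᴿ ys
∑ᴿ-++ [] ys = ⟨ (λ k → sym (ℚ.+-identityˡ (seq (∑ᴿ ys) k))) ⟩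
∑ᴿ-++ (x ∷ xs) ys = ⟨ (λ k →
  trans (cong (seq x k ℚ.+_) (pointwise (∑ᴿ-++ xs ys) k))
        (sym (ℚ.+-assoc (seq x k) (seq (∑ᴿ xs) k) (seq (∑ᴿ ys) k)))) ⟩

∑ᴿ-map-scale : ∀ {A B : Set} κ (v : A → ℝ) (w : B → ℝ) (f : A → B) →
  (∀ a → w (f a) ≈ κ *ᴿ v a) →
  ∀ as → ∑ᴿ (map w (map f as)) ≈ κ *ᴿ ∑ᴿ (map v as)
∑ᴿ-map-scale κ v w f h [] = ⟨ (λ k → sym (ℚ.*-zeroʳ (seq κ k))) ⟩
∑ᴿ-map-scale κ v w f h (a ∷ as) = ⟨ (λ k →
  trans (cong₂ ℚ._+_ (pointwise (h a) k) (pointwise (∑ᴿ-map-scale κ v w f h as) k))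
        (sym (ℚ.*-distribˡ-+ (seq κ k) (seq (v a) k) (seq (∑ᴿ (map v as)) k)))) ⟩

-- The list `bs` is tied to its decomposition by an equation, so that `members-suc` can be passed as
-- an argument and matched away.
∑ᴿ-split : ∀ {A B : Set} κ₀ κ₁ (v : A → ℝ) (w : B → ℝ) (f₀ f₁ : A → B) →
  (∀ a → w (f₀ a) ≈ κ₀ *ᴿ v a) → (∀ a → w (f₁ a) ≈ κ₁ *ᴿ v a) →
  ∀ as₀ as₁ bs → bs ≡ map f₀ as₀ ++ map f₁ as₁ →
  ∑ᴿ (map w bs) ≈ κ₀ *ᴿ ∑ᴿ (map v as₀) +ᴿ κ₁ *ᴿ ∑ᴿ (map v as₁)
∑ᴿ-split κ₀ κ₁ v w f₀ f₁ h₀ h₁ as₀ as₁ _ refl =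
  subst (λ xs → ∑ᴿ xs ≈ κ₀ *ᴿ ∑ᴿ (map v as₀) +ᴿ κ₁ *ᴿ ∑ᴿ (map v as₁))
    (sym (map-++ w (map f₀ as₀) (map f₁ as₁)))
    (≈-trans (∑ᴿ-++ (map w (map f₀ as₀)) (map w (map f₁ as₁)))
      (+ᴿ-cong (∑ᴿ (map w (map f₀ as₀))) (κ₀ *ᴿ ∑ᴿ (map v as₀))
               (∑ᴿ (map w (map f₁ as₁))) (κ₁ *ᴿ ∑ᴿ (map v as₁))
        (∑ᴿ-map-scale κ₀ v w f₀ h₀ as₀) (∑ᴿ-map-scale κ₁ v w f₁ h₁ as₁)))

filterᵇ-map : ∀ {A B : Set} (f : A → B) (P : B → Bool) xs →
  filterᵇ P (map f xs) ≡ map f (filterᵇ (P ∘ f) xs)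
filterᵇ-map f P [] = refl
filterᵇ-map f P (x ∷ xs) with P (f x)
... | false = filterᵇ-map f P xs
... | true = cong (f x ∷_) (filterᵇ-map f P xs)

members-suc : (𝓕 : Family (suc n)) →
  members 𝓕 ≡ map (outside Vec.∷_) (members (𝓕 ⁰)) ++ map (inside Vec.∷_) (members (𝓕 ¹))
members-suc {n} 𝓕 = trans
  (filter-++ (T? ∘ 𝓕) (map (outside Vec.∷_) (allSubsets n)) _)
  (cong₂ _++_ (filterᵇ-map (outside Vec.∷_) 𝓕 (allSubsets n))
              (filterᵇ-map (inside Vec.∷_) 𝓕 (allSubsets n)))

^*^-inside : ∀ x y a b → x ^ᴿ suc a *ᴿ y ^ᴿ b ≈ x *ᴿ (x ^ᴿ a *ᴿ y ^ᴿ b)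
^*^-inside x y a b = ⟨ (λ k →
  ℚ.*-assoc (seq x k) (seq (x ^ᴿ a) k) (seq (y ^ᴿ b) k)) ⟩

^*^-outside : ∀ x y a b → x ^ᴿ a *ᴿ y ^ᴿ suc b ≈ y *ᴿ (x ^ᴿ a *ᴿ y ^ᴿ b)
^*^-outside x y a b = ⟨ (λ k →
  rearrange (seq (x ^ᴿ a) k) (seq y k) (seq (y ^ᴿ b) k)) ⟩
  where
  rearrange : ∀ a b c → a ℚ.* (b ℚ.* c) ≡ b ℚ.* (a ℚ.* c)
  rearrange = solve 3 (λ a b c → a :* (b :* c) := b :* (a :* c)) refl

weight-≡ : ∀ n p (G : Subset n) a b → ∣ G ∣ ≡ a → n ∸ ∣ G ∣ ≡ b →
  weight p G ≡ p ^ᴿ a *ᴿ (1ᴿ -ᴿ p) ^ᴿ b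
weight-≡ n p G _ _ refl refl = refl

weight-inside : ∀ p (G : Subset n) → weight p (inside Vec.∷ G) ≈ p *ᴿ weight p G
weight-inside {n} p G =
  subst (λ w → weight p (inside Vec.∷ G) ≈ p *ᴿ w)
    {p ^ᴿ a *ᴿ (1ᴿ -ᴿ p) ^ᴿ b} {weight p G} (sym (weight-≡ n p G a b refl refl))
    (subst (λ w → w ≈ p *ᴿ (p ^ᴿ a *ᴿ (1ᴿ -ᴿ p) ^ᴿ b))
      (sym (weight-≡ (suc n) p (inside Vec.∷ G) (suc a) b refl refl))
      (^*^-inside p (1ᴿ -ᴿ p) a b))
  where
  a = ∣ G ∣
  b = n ∸ ∣ G ∣

weight-outside : ∀ p (G : Subset n) →
  weight p (outside Vec.∷ G) ≈ (1ᴿ -ᴿ p) *ᴿ weight p G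
weight-outside {n} p G =
  subst (λ w → weight p (outside Vec.∷ G) ≈ (1ᴿ -ᴿ p) *ᴿ w)
    {p ^ᴿ a *ᴿ (1ᴿ -ᴿ p) ^ᴿ b} {weight p G} (sym (weight-≡ n p G a b refl refl))
    (subst (λ w → w ≈ (1ᴿ -ᴿ p) *ᴿ (p ^ᴿ a *ᴿ (1ᴿ -ᴿ p) ^ᴿ b))
      (sym (weight-≡ (suc n) p (outside Vec.∷ G) a (suc b) refl
        -- Subtraction is truncated, so `suc` moves out of it only because ∣ G ∣ ≤ n.
        (ℕ.+-∸-assoc 1 (∣p∣≤n G))))
      (^*^-outside p (1ᴿ -ᴿ p) a b))
  where
  a = ∣ G ∣
  b = n ∸ ∣ G ∣

-- Expectation over the first point, which is absent with probability 1 - p and present with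
-- probability p.
mix : ℝ → ℝ → ℝ → ℝ
mix p x y = (1ᴿ -ᴿ p) *ᴿ x +ᴿ p *ᴿ y

μ-suc : ∀ p (𝓕 : Family (suc n)) → μ p 𝓕 ≈ mix p (μ p (𝓕 ⁰)) (μ p (𝓕 ¹))
μ-suc {n} p 𝓕 = from-sums (μ p (𝓕 ⁰)) (μ p (𝓕 ¹)) refl refl
  where
  -- Equations keep Agda from unfolding the Cauchy proofs of the two measures.
  from-sums : ∀ x y →
    ∑ᴿ (map (weight {n} p) (members (𝓕 ⁰))) ≡ x →
    ∑ᴿ (map (weight {n} p) (members (𝓕 ¹))) ≡ y →
    μ p 𝓕 ≈ mix p x y
  from-sums _ _ refl refl = ∑ᴿ-split (1ᴿ -ᴿ p) p (weight {n} p) (weight {suc n} p)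
    (outside Vec.∷_) (inside Vec.∷_) (weight-outside p) (weight-inside p)
    (members (𝓕 ⁰)) (members (𝓕 ¹)) (members 𝓕) (members-suc 𝓕)

indicator : Bool → ℝ
indicator b = if b then 1ᴿ else 0ᴿ

μ-zero : ∀ p (𝓕 : Family 0) → μ p 𝓕 ≈ indicator (𝓕 Vec.[])
μ-zero p 𝓕 = evaluate (𝓕 Vec.[]) (members 𝓕) members-zero
  where
  members-zero : members 𝓕 ≡ (if 𝓕 Vec.[] then Vec.[] ∷ [] else [])
  members-zero with 𝓕 Vec.[]
  ... | false = refl
  ... | true = refl
  evaluate : ∀ b Gs → Gs ≡ (if b then Vec.[] ∷ [] else []) →
    ∑ᴿ (map (weight {0} p) Gs) ≈ indicator b
  evaluate false _ refl = ⟨ (λ _ → refl) ⟩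
  evaluate true _ refl = ⟨ (λ _ → refl) ⟩

-- Base case of the estimates on `μ`: comparison with `false` or `true` yields the bounds 0 and 1.
indicator-mono : ∀ {a b} → (T a → T b) → indicator a ⊑ indicator b
indicator-mono {false} {false} _ = ⊑-reflexive ≈-refl
indicator-mono {false} {true} _ = 0⊑const 1ℚ (ℚ.nonNegative⁻¹ 1ℚ)
indicator-mono {true} {false} h = ⊥-elim (h _)
indicator-mono {true} {true} _ = ⊑-reflexive ≈-refl

mix-const : ∀ p r → mix p (fromℚ r) (fromℚ r) ≈ fromℚ r
mix-const p r = ⟨ (λ k → identity (seq p k) r) ⟩
  where
  identity : ∀ a r → (1ℚ ℚ.- a) ℚ.* r ℚ.+ a ℚ.* r ≡ r
  identity = solve 2 (λ a r → (con 1ℚ :- a) :* r :+ a :* r := r) refl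

mix-mono : ∀ p x y u v → 0ᴿ ⊑ p → p ⊑ 1ᴿ → x ⊑ y → u ⊑ v → mix p x u ⊑ mix p y v
mix-mono p x y u v 0⊑p p⊑1 x⊑y u⊑v =
  ⊑-from-gap (0⊑x+y (0⊑x*y (0⊑y-x p⊑1) (0⊑y-x x⊑y)) (0⊑x*y 0⊑p (0⊑y-x u⊑v)))
    λ k → identity (seq p k) (seq x k) (seq y k) (seq u k) (seq v k)
  where
  identity : ∀ p x y u v →
    (1ℚ ℚ.- p) ℚ.* y ℚ.+ p ℚ.* v ≡
    ((1ℚ ℚ.- p) ℚ.* x ℚ.+ p ℚ.* u) ℚ.+
    ((1ℚ ℚ.- p) ℚ.* (y ℚ.- x) ℚ.+ p ℚ.* (v ℚ.- u))
  identity = solve 5 (λ p x y u v →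
    (con 1ℚ :- p) :* y :+ p :* v :=
    ((con 1ℚ :- p) :* x :+ p :* u) :+
    ((con 1ℚ :- p) :* (y :- x) :+ p :* (v :- u))) refl

module Measure (p : ℝ) (0⊑p : 0ᴿ ⊑ p) (p⊑1 : p ⊑ 1ᴿ) where

  μ-suc-⊑ : ∀ (𝓕 : Family (suc n)) x y →
    μ p (𝓕 ⁰) ⊑ x → μ p (𝓕 ¹) ⊑ y → μ p 𝓕 ⊑ mix p x y
  μ-suc-⊑ 𝓕 x y h⁰ h¹ = ⊑-trans (⊑-reflexive (μ-suc p 𝓕))
    (mix-mono p (μ p (𝓕 ⁰)) x (μ p (𝓕 ¹)) y 0⊑p p⊑1 h⁰ h¹)

  μ-suc-⊒ : ∀ (𝓕 : Family (suc n)) x y →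
    x ⊑ μ p (𝓕 ⁰) → y ⊑ μ p (𝓕 ¹) → mix p x y ⊑ μ p 𝓕
  μ-suc-⊒ 𝓕 x y h⁰ h¹ = ⊑-trans
    (mix-mono p x (μ p (𝓕 ⁰)) y (μ p (𝓕 ¹)) 0⊑p p⊑1 h⁰ h¹)
    (⊑-reflexive (≈-sym (μ-suc p 𝓕)))

  -- Recursion on sections avoids comparing the filtered lists of members. The next three bounds
  -- follow the same pattern, since `mix` fixes constants.
  μ-mono : ∀ {n} (𝓕 𝓖 : Family n) → (∀ G → G ∈ᶠ 𝓕 → G ∈ᶠ 𝓖) → μ p 𝓕 ⊑ μ p 𝓖
  μ-mono {zero} 𝓕 𝓖 𝓕⊆𝓖 = ⊑-trans (⊑-reflexive (μ-zero p 𝓕))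
    (⊑-trans (indicator-mono (𝓕⊆𝓖 Vec.[])) (⊑-reflexive (≈-sym (μ-zero p 𝓖))))
  μ-mono {suc n} 𝓕 𝓖 𝓕⊆𝓖 = ⊑-trans (⊑-reflexive (μ-suc p 𝓕))
    (μ-suc-⊒ 𝓖 (μ p (𝓕 ⁰)) (μ p (𝓕 ¹))
      (μ-mono (𝓕 ⁰) (𝓖 ⁰) (λ G → 𝓕⊆𝓖 (outside Vec.∷ G)))
      (μ-mono (𝓕 ¹) (𝓖 ¹) (λ G → 𝓕⊆𝓖 (inside Vec.∷ G))))

  0⊑μ : ∀ {n} (𝓕 : Family n) → 0ᴿ ⊑ μ p 𝓕
  0⊑μ {zero} 𝓕 = ⊑-trans (indicator-mono {false} {𝓕 Vec.[]} λ ()) (⊑-reflexive (≈-sym (μ-zero p 𝓕)))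
  0⊑μ {suc n} 𝓕 = ⊑-trans (⊑-reflexive (≈-sym (mix-const p 0ℚ)))
    (μ-suc-⊒ 𝓕 (fromℚ 0ℚ) (fromℚ 0ℚ) (0⊑μ (𝓕 ⁰)) (0⊑μ (𝓕 ¹)))

  μ⊑1 : ∀ {n} (𝓕 : Family n) → μ p 𝓕 ⊑ 1ᴿ
  μ⊑1 {zero} 𝓕 = ⊑-trans (⊑-reflexive (μ-zero p 𝓕)) (indicator-mono {𝓕 Vec.[]} {true} _)
  μ⊑1 {suc n} 𝓕 = ⊑-trans (μ-suc-⊑ 𝓕 (fromℚ 1ℚ) (fromℚ 1ℚ) (μ⊑1 (𝓕 ⁰)) (μ⊑1 (𝓕 ¹)))
    (⊑-reflexive (mix-const p 1ℚ))

  μ-vacant : ∀ {n} (𝓕 : Family n) → Vacant 𝓕 → μ p 𝓕 ⊑ 0ᴿ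
  μ-vacant {zero} 𝓕 vacant = ⊑-trans (⊑-reflexive (μ-zero p 𝓕))
    (indicator-mono {𝓕 Vec.[]} {false} (vacant Vec.[]))
  μ-vacant {suc n} 𝓕 vacant = ⊑-trans
    (μ-suc-⊑ 𝓕 (fromℚ 0ℚ) (fromℚ 0ℚ)
      (μ-vacant (𝓕 ⁰) (λ G → vacant (outside Vec.∷ G)))
      (μ-vacant (𝓕 ¹) (λ G → vacant (inside Vec.∷ G))))
    (⊑-reflexive (mix-const p 0ℚ))

  μ⁰⊑μ⁺ : ∀ (𝓕 : Family (suc n)) → μ p (𝓕 ⁰) ⊑ μ p (𝓕 ⁺)
  μ⁰⊑μ⁺ 𝓕 = μ-mono (𝓕 ⁰) (𝓕 ⁺) (λ _ → ∈-∪ᶠˡ (𝓕 ⁰) (𝓕 ¹))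

  -- Enlarging `𝓕 ¹` to `𝓕 ⁺` expresses the estimate through the families to which the induction
  -- hypothesis applies.
  μ⊑mix : ∀ (𝓕 : Family (suc n)) → μ p 𝓕 ⊑ mix p (μ p (𝓕 ⁰)) (μ p (𝓕 ⁺))
  μ⊑mix 𝓕 = μ-suc-⊑ 𝓕 (μ p (𝓕 ⁰)) (μ p (𝓕 ⁺))
    (⊑-reflexive ≈-refl) (μ-mono (𝓕 ¹) (𝓕 ⁺) (λ _ → ∈-∪ᶠʳ (𝓕 ⁰) (𝓕 ¹)))

  -- Supplies the value m = p in the exceptional case of the shifted induction.
  μ-star : ∀ (𝓕 : Family n) → Star 𝓕 → μ p 𝓕 ⊑ p
  μ-star {zero} _ ()
  μ-star {suc n} 𝓕 star = ⊑-trans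
    (μ-suc-⊑ 𝓕 0ᴿ 1ᴿ (μ-vacant (𝓕 ⁰) star) (μ⊑1 (𝓕 ¹)))
    (⊑-reflexive ⟨ (λ k → identity (seq p k)) ⟩)
    where
    identity : ∀ p → (1ℚ ℚ.- p) ℚ.* 0ℚ ℚ.+ p ℚ.* 1ℚ ≡ p
    identity = solve 1 (λ p →
      (con 1ℚ :- p) :* con 0ℚ :+ p :* con 1ℚ := p) refl

-- Cross intersecting families

swap₁₂ : ∀ (𝓕₁ 𝓕₂ 𝓕₃ : Family n) →
  NonemptyCrossIntersecting₃ 𝓕₁ 𝓕₂ 𝓕₃ → NonemptyCrossIntersecting₃ 𝓕₂ 𝓕₁ 𝓕₃
swap₁₂ _ _ _ (ne₁ , ne₂ , ne₃ , cross) = ne₂ , ne₁ , ne₃ , λ F₂ F₁ F₃ ∈₂ ∈₁ ∈₃ →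
  subst Nonempty
    (trans (sym (∩-assoc F₁ F₂ F₃))
      (trans (cong (_∩ F₃) (∩-comm F₁ F₂)) (∩-assoc F₂ F₁ F₃)))
    (cross F₁ F₂ F₃ ∈₁ ∈₂ ∈₃)

swap₂₃ : ∀ (𝓕₁ 𝓕₂ 𝓕₃ : Family n) →
  NonemptyCrossIntersecting₃ 𝓕₁ 𝓕₂ 𝓕₃ → NonemptyCrossIntersecting₃ 𝓕₁ 𝓕₃ 𝓕₂
swap₂₃ _ _ _ (ne₁ , ne₂ , ne₃ , cross) = ne₁ , ne₃ , ne₂ , λ F₁ F₃ F₂ ∈₁ ∈₃ ∈₂ →
  subst Nonempty (cong (F₁ ∩_) (∩-comm F₂ F₃)) (cross F₁ F₂ F₃ ∈₁ ∈₂ ∈₃)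

-- The base case of both inductions is void: the three members would need a common point in an empty
-- ground set.
cross-zero : ∀ (𝓕₁ 𝓕₂ 𝓕₃ : Family 0) → ¬ NonemptyCrossIntersecting₃ 𝓕₁ 𝓕₂ 𝓕₃
cross-zero _ _ _ ((F₁ , ∈₁) , (F₂ , ∈₂) , (F₃ , ∈₃) , cross)
  with cross F₁ F₂ F₃ ∈₁ ∈₂ ∈₃
... | () , _

extend : ∀ (𝓕 : Family (suc n)) {G} → G ∈ᶠ 𝓕 ⁺ → ∃[ s ] (s Vec.∷ G) ∈ᶠ 𝓕
extend 𝓕 G∈ with ∈-∪ᶠ⁻ (𝓕 ⁰) (𝓕 ¹) G∈
... | inj₁ ∈⁰ = outside , ∈⁰
... | inj₂ ∈¹ = inside , ∈¹

nonempty-⁺ : ∀ (𝓕 : Family (suc n)) → NonemptyFamily 𝓕 → NonemptyFamily (𝓕 ⁺)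
nonempty-⁺ 𝓕 (outside Vec.∷ G , G∈) = G , ∈-∪ᶠˡ (𝓕 ⁰) (𝓕 ¹) G∈
nonempty-⁺ 𝓕 (inside Vec.∷ G , G∈) = G , ∈-∪ᶠʳ (𝓕 ⁰) (𝓕 ¹) G∈

-- The set extending a member of `𝓕₁ ⁰` avoids the first point. So the common point is a later one
-- and survives deletion of the first, whichever sections the other two sets come from.
cross-section₁ : ∀ (𝓕₁ 𝓕₂ 𝓕₃ : Family (suc n)) →
  NonemptyCrossIntersecting₃ 𝓕₁ 𝓕₂ 𝓕₃ → NonemptyFamily (𝓕₁ ⁰) →
  NonemptyCrossIntersecting₃ (𝓕₁ ⁰) (𝓕₂ ⁺) (𝓕₃ ⁺)
cross-section₁ 𝓕₁ 𝓕₂ 𝓕₃ (_ , ne₂ , ne₃ , cross) ne₁⁰ =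
  ne₁⁰ , nonempty-⁺ 𝓕₂ ne₂ , nonempty-⁺ 𝓕₃ ne₃ , meet
  where
  meet : CrossIntersecting₃ (𝓕₁ ⁰) (𝓕₂ ⁺) (𝓕₃ ⁺)
  meet F₁ F₂ F₃ ∈₁ ∈₂ ∈₃ with extend 𝓕₂ ∈₂ | extend 𝓕₃ ∈₃
  ... | s , ∈₂′ | t , ∈₃′
    with cross (outside Vec.∷ F₁) (s Vec.∷ F₂) (t Vec.∷ F₃) ∈₁ ∈₂′ ∈₃′
  ... | suc i , Vec.there i∈ = i , i∈

cross-section₂ : ∀ (𝓕₁ 𝓕₂ 𝓕₃ : Family (suc n)) →
  NonemptyCrossIntersecting₃ 𝓕₁ 𝓕₂ 𝓕₃ → NonemptyFamily (𝓕₂ ⁰) →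
  NonemptyCrossIntersecting₃ (𝓕₁ ⁺) (𝓕₂ ⁰) (𝓕₃ ⁺)
cross-section₂ 𝓕₁ 𝓕₂ 𝓕₃ cross ne₂⁰ = swap₁₂ (𝓕₂ ⁰) (𝓕₁ ⁺) (𝓕₃ ⁺)
  (cross-section₁ 𝓕₂ 𝓕₁ 𝓕₃ (swap₁₂ 𝓕₁ 𝓕₂ 𝓕₃ cross) ne₂⁰)

cross-section₃ : ∀ (𝓕₁ 𝓕₂ 𝓕₃ : Family (suc n)) →
  NonemptyCrossIntersecting₃ 𝓕₁ 𝓕₂ 𝓕₃ → NonemptyFamily (𝓕₃ ⁰) →
  NonemptyCrossIntersecting₃ (𝓕₁ ⁺) (𝓕₂ ⁺) (𝓕₃ ⁰)
cross-section₃ 𝓕₁ 𝓕₂ 𝓕₃ cross ne₃⁰ = swap₂₃ (𝓕₁ ⁺) (𝓕₃ ⁰) (𝓕₂ ⁺)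
  (cross-section₂ 𝓕₁ 𝓕₃ 𝓕₂ (swap₂₃ 𝓕₁ 𝓕₂ 𝓕₃ cross) ne₃⁰)

-- Shifted families

shifted-⁰ : ∀ (𝓕 : Family (suc n)) → Shifted 𝓕 → Shifted (𝓕 ⁰)
shifted-⁰ 𝓕 shifted F i j F∈ i<j eq =
  shifted (outside Vec.∷ F) (suc i) (suc j) F∈ (ℕ.s<s i<j) (cong (outside Vec.∷_) eq)

shifted-¹ : ∀ (𝓕 : Family (suc n)) → Shifted 𝓕 → Shifted (𝓕 ¹)
shifted-¹ 𝓕 shifted F i j F∈ i<j eq =
  -- The head is `outside` here too, because the pair being shifted does not contain the first
  -- point.
  shifted (inside Vec.∷ F) (suc i) (suc j) F∈ (ℕ.s<s i<j) (cong (outside Vec.∷_) eq)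

shifted-∪ᶠ : ∀ (𝓕 𝓖 : Family n) → Shifted 𝓕 → Shifted 𝓖 → Shifted (𝓕 ∪ᶠ 𝓖)
shifted-∪ᶠ 𝓕 𝓖 sh₁ sh₂ F i j F∈ i<j eq with ∈-∪ᶠ⁻ 𝓕 𝓖 F∈
... | inj₁ F∈𝓕 = ∈-∪ᶠˡ 𝓕 𝓖 (sh₁ F i j F∈𝓕 i<j eq)
... | inj₂ F∈𝓖 = ∈-∪ᶠʳ 𝓕 𝓖 (sh₂ F i j F∈𝓖 i<j eq)

shifted-⁺ : ∀ (𝓕 : Family (suc n)) → Shifted 𝓕 → Shifted (𝓕 ⁺)
shifted-⁺ 𝓕 shifted =
  shifted-∪ᶠ (𝓕 ⁰) (𝓕 ¹) (shifted-⁰ 𝓕 shifted) (shifted-¹ 𝓕 shifted)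

-- A star `𝓕 ⁺` would force the second point of the ground set into every member of 𝓕. A member of
-- `𝓕 ⁰` either misses that point already or loses it by shifting it to the first point. If there is
-- no second point, `Star` is empty by definition.
¬star-⁺ : ∀ (𝓕 : Family (suc n)) →
  Shifted 𝓕 → NonemptyFamily (𝓕 ⁰) → ¬ Star (𝓕 ⁺)
¬star-⁺ {zero} _ _ _ ()
¬star-⁺ {suc n} 𝓕 _ (outside Vec.∷ G , G∈) star =
  star G (∈-∪ᶠˡ (𝓕 ⁰) (𝓕 ¹) {outside Vec.∷ G} G∈)
¬star-⁺ {suc n} 𝓕 shifted (inside Vec.∷ G , G∈) star =
  star _ (∈-∪ᶠʳ (𝓕 ⁰) (𝓕 ¹) {outside Vec.∷ _}
    (shifted (outside Vec.∷ inside Vec.∷ G) zero (suc zero) G∈ ℕ.z<s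
      -- The first two entries agree by computation; beyond them the pair of points leaves ⊥ ∪ ⊥,
      -- whose intersection with `G` is ⊥.
      (cong (λ H → outside Vec.∷ inside Vec.∷ H)
        (trans (cong (G ∩_) (∪-idem ⊥)) (∩-zeroʳ G)))))

-- Two adjacent transpositions generate all permutations, so it is enough to treat the cases with
-- the `P` entries in front. Three `P` entries are handed back, because the two inductions conclude
-- differently there.
up-to-permutation : ∀ {A : Set} {P Q : A → Set} → (∀ a → P a ⊎ Q a) →
  (R : A → A → A → Set) →
  (∀ a b c → R a b c → R b a c) → (∀ a b c → R a b c → R a c b) →
  (∀ a b c → Q a → Q b → Q c → R a b c) →
  (∀ a b c → P a → Q b → Q c → R a b c) →
  (∀ a b c → P a → P b → Q c → R a b c) →
  ∀ a b c → R a b c ⊎ (P a × P b × P c)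
up-to-permutation P⊎Q R s₁₂ s₂₃ none one two a b c with P⊎Q a | P⊎Q b | P⊎Q c
... | inj₂ x | inj₂ y | inj₂ z = inj₁ (none a b c x y z)
... | inj₁ x | inj₂ y | inj₂ z = inj₁ (one a b c x y z)
... | inj₂ x | inj₁ y | inj₂ z = inj₁ (s₁₂ b a c (one b a c y x z))
... | inj₂ x | inj₂ y | inj₁ z = inj₁ (s₂₃ a c b (s₁₂ c a b (one c a b z x y)))
... | inj₁ x | inj₁ y | inj₂ z = inj₁ (two a b c x y z)
... | inj₁ x | inj₂ y | inj₁ z = inj₁ (s₂₃ a c b (two a c b x z y))
... | inj₂ x | inj₁ y | inj₁ z = inj₁ (s₁₂ b a c (s₂₃ b c a (two b c a y z x)))
... | inj₁ x | inj₁ y | inj₁ z = inj₂ (x , y , z)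

-- Inequalities between the measures of the sections

+ᴿ-mono₃ : ∀ x y z x′ y′ z′ → x ⊑ x′ → y ⊑ y′ → z ⊑ z′ →
  x +ᴿ y +ᴿ z ⊑ x′ +ᴿ y′ +ᴿ z′
+ᴿ-mono₃ x y z x′ y′ z′ hx hy hz =
  ⊑-from-gap (0⊑x+y (0⊑x+y (0⊑y-x hx) (0⊑y-x hy)) (0⊑y-x hz))
    λ k → solve 6 (λ x y z x′ y′ z′ →
      x′ :+ y′ :+ z′ := (x :+ y :+ z) :+ (((x′ :- x) :+ (y′ :- y)) :+ (z′ :- z)))
      refl (seq x k) (seq y k) (seq z k) (seq x′ k) (seq y′ k) (seq z′ k)

+ᴿ-swap₁₂ : ∀ x y z c → x +ᴿ y +ᴿ z ⊑ c → y +ᴿ x +ᴿ z ⊑ c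
+ᴿ-swap₁₂ x y z c h = ⊑-trans
  (⊑-reflexive ⟨ (λ k → cong (ℚ._+ seq z k) (ℚ.+-comm (seq y k) (seq x k))) ⟩) h

+ᴿ-swap₂₃ : ∀ x y z c → x +ᴿ y +ᴿ z ⊑ c → x +ᴿ z +ᴿ y ⊑ c
+ᴿ-swap₂₃ x y z c h = ⊑-trans
  (⊑-reflexive ⟨ (λ k → solve 3 (λ x y z → x :+ z :+ y := x :+ y :+ z) refl
    (seq x k) (seq y k) (seq z k)) ⟩) h

-- Estimates for p between 1/3 and 1/2

module Range (p : ℝ) (⅓⊑p : fromℚ (+ 1 / 3) ⊑ p) (p⊑½ : p ⊑ fromℚ (+ 1 / 2)) where

  3p bound : ℝ
  3p = fromℚ (+ 3 / 1) *ᴿ p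
  bound = fromℚ (+ 3 / 1) *ᴿ p -ᴿ ε p

  0⊑p : 0ᴿ ⊑ p
  0⊑p = ⊑-from-gap
    (0⊑x+y (0⊑y-x ⅓⊑p) (0⊑const (+ 1 / 3) (ℚ.nonNegative⁻¹ (+ 1 / 3))))
    λ k → solve 1 (λ p → p := con 0ℚ :+ ((p :- con (+ 1 / 3)) :+ con (+ 1 / 3)))
      refl (seq p k)

  p⊑1 : p ⊑ 1ᴿ
  p⊑1 = ⊑-from-gap
    (0⊑x+y (0⊑y-x p⊑½) (0⊑const (+ 1 / 2) (ℚ.nonNegative⁻¹ (+ 1 / 2))))
    λ k → solve 1 (λ p → con 1ℚ := p :+ ((con (+ 1 / 2) :- p) :+ con (+ 1 / 2)))
      refl (seq p k)

  -- The average of the three hypotheses exceeds the left side by 2/3 - p times the sum of the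
  -- differences yᵢ - xᵢ. The factor 2/3 - p is split as (1/2 - p) + 1/6.
  mix-sum-0 : ∀ c x₁ x₂ x₃ y₁ y₂ y₃ → x₁ ⊑ y₁ → x₂ ⊑ y₂ → x₃ ⊑ y₃ →
    x₁ +ᴿ y₂ +ᴿ y₃ ⊑ c → y₁ +ᴿ x₂ +ᴿ y₃ ⊑ c → y₁ +ᴿ y₂ +ᴿ x₃ ⊑ c →
    mix p x₁ y₁ +ᴿ mix p x₂ y₂ +ᴿ mix p x₃ y₃ ⊑ c
  mix-sum-0 c x₁ x₂ x₃ y₁ y₂ y₃ x₁⊑y₁ x₂⊑y₂ x₃⊑y₃ h₁ h₂ h₃ = ⊑-from-gap
    (0⊑x+y
      (0⊑x*y (0⊑const (+ 1 / 3) (ℚ.nonNegative⁻¹ (+ 1 / 3)))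
        (0⊑x+y (0⊑x+y (0⊑y-x h₁) (0⊑y-x h₂)) (0⊑y-x h₃)))
      (0⊑x*y (0⊑x+y (0⊑y-x p⊑½) (0⊑const (+ 1 / 6) (ℚ.nonNegative⁻¹ (+ 1 / 6))))
        (0⊑x+y (0⊑x+y (0⊑y-x x₁⊑y₁) (0⊑y-x x₂⊑y₂)) (0⊑y-x x₃⊑y₃))))
    λ k → solve 8 (λ p c x₁ x₂ x₃ y₁ y₂ y₃ →
      c := (((con 1ℚ :- p) :* x₁ :+ p :* y₁) :+ ((con 1ℚ :- p) :* x₂ :+ p :* y₂)
              :+ ((con 1ℚ :- p) :* x₃ :+ p :* y₃))
        :+ (con (+ 1 / 3) :* (((c :- (x₁ :+ y₂ :+ y₃)) :+ (c :- (y₁ :+ x₂ :+ y₃)))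
              :+ (c :- (y₁ :+ y₂ :+ x₃)))
          :+ ((con (+ 1 / 2) :- p) :+ con (+ 1 / 6))
              :* (((y₁ :- x₁) :+ (y₂ :- x₂)) :+ (y₃ :- x₃))))
      refl (seq p k) (seq c k) (seq x₁ k) (seq x₂ k) (seq x₃ k)
        (seq y₁ k) (seq y₂ k) (seq y₃ k)

  -- The average of the two hypotheses gives y₂ - x₂ and y₃ - x₃ the coefficient 1/2 - p, which is
  -- where p ≤ 1/2 enters. The first family leaves the surplus (1 - p)(y₁ - x₁).
  mix-sum-1 : ∀ c x₁ x₂ x₃ y₁ y₂ y₃ →
    x₁ ⊑ 0ᴿ → 0ᴿ ⊑ y₁ → x₂ ⊑ y₂ → x₃ ⊑ y₃ →
    y₁ +ᴿ x₂ +ᴿ y₃ ⊑ c → y₁ +ᴿ y₂ +ᴿ x₃ ⊑ c →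
    mix p x₁ y₁ +ᴿ mix p x₂ y₂ +ᴿ mix p x₃ y₃ ⊑ c
  mix-sum-1 c x₁ x₂ x₃ y₁ y₂ y₃ x₁⊑0 0⊑y₁ x₂⊑y₂ x₃⊑y₃ h₂ h₃ = ⊑-from-gap
    (0⊑x+y (0⊑x+y
      (0⊑x*y (0⊑const (+ 1 / 2) (ℚ.nonNegative⁻¹ (+ 1 / 2)))
        (0⊑x+y (0⊑y-x h₂) (0⊑y-x h₃)))
      (0⊑x*y (0⊑y-x p⊑1) (0⊑x+y 0⊑y₁ (0⊑y-x x₁⊑0))))
      (0⊑x*y (0⊑y-x p⊑½) (0⊑x+y (0⊑y-x x₂⊑y₂) (0⊑y-x x₃⊑y₃))))
    λ k → solve 8 (λ p c x₁ x₂ x₃ y₁ y₂ y₃ →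
      c := (((con 1ℚ :- p) :* x₁ :+ p :* y₁) :+ ((con 1ℚ :- p) :* x₂ :+ p :* y₂)
              :+ ((con 1ℚ :- p) :* x₃ :+ p :* y₃))
        :+ (con (+ 1 / 2) :* ((c :- (y₁ :+ x₂ :+ y₃)) :+ (c :- (y₁ :+ y₂ :+ x₃)))
          :+ (con 1ℚ :- p) :* (y₁ :+ (con 0ℚ :- x₁))
          :+ (con (+ 1 / 2) :- p) :* ((y₂ :- x₂) :+ (y₃ :- x₃))))
      refl (seq p k) (seq c k) (seq x₁ k) (seq x₂ k) (seq x₃ k)
        (seq y₁ k) (seq y₂ k) (seq y₃ k)

  -- The coefficient 1 - 2p appears as 2 · (1/2 - p), a multiple of the gap in `p⊑½`.
  extremal : ℝ → ℝ → ℝ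
  extremal c m = p *ᴿ c +ᴿ (fromℚ (+ 2 / 1) *ᴿ (fromℚ (+ 1 / 2) -ᴿ p)) *ᴿ m +ᴿ p

  -- The terms p (y₁ + y₂) are at most p (c - x₃). Together with (1 - p) x₃ this leaves (1 - 2p) x₃,
  -- and p y₃ is at most p.
  mix-sum-2 : ∀ c m x₁ x₂ x₃ y₁ y₂ y₃ →
    x₁ ⊑ 0ᴿ → x₂ ⊑ 0ᴿ → x₃ ⊑ m → y₃ ⊑ 1ᴿ → y₁ +ᴿ y₂ +ᴿ x₃ ⊑ c →
    mix p x₁ y₁ +ᴿ mix p x₂ y₂ +ᴿ mix p x₃ y₃ ⊑ extremal c m
  mix-sum-2 c m x₁ x₂ x₃ y₁ y₂ y₃ x₁⊑0 x₂⊑0 x₃⊑m y₃⊑1 h₃ = ⊑-from-gap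
    (0⊑x+y (0⊑x+y
      (0⊑x*y 0⊑p (0⊑x+y (0⊑y-x h₃) (0⊑y-x y₃⊑1)))
      (0⊑x*y (0⊑x*y (0⊑const (+ 2 / 1) (ℚ.nonNegative⁻¹ (+ 2 / 1))) (0⊑y-x p⊑½))
        (0⊑y-x x₃⊑m)))
      (0⊑x*y (0⊑y-x p⊑1) (0⊑x+y (0⊑y-x x₁⊑0) (0⊑y-x x₂⊑0))))
    λ k → solve 9 (λ p c m x₁ x₂ x₃ y₁ y₂ y₃ →
      (p :* c :+ (con (+ 2 / 1) :* (con (+ 1 / 2) :- p)) :* m :+ p) :=
        (((con 1ℚ :- p) :* x₁ :+ p :* y₁) :+ ((con 1ℚ :- p) :* x₂ :+ p :* y₂)
              :+ ((con 1ℚ :- p) :* x₃ :+ p :* y₃))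
        :+ (p :* ((c :- (y₁ :+ y₂ :+ x₃)) :+ (con 1ℚ :- y₃))
          :+ (con (+ 2 / 1) :* (con (+ 1 / 2) :- p)) :* (m :- x₃)
          :+ (con 1ℚ :- p) :* ((con 0ℚ :- x₁) :+ (con 0ℚ :- x₂))))
      refl (seq p k) (seq c k) (seq m k) (seq x₁ k) (seq x₂ k) (seq x₃ k)
        (seq y₁ k) (seq y₂ k) (seq y₃ k)

  mix-sum-3 : ∀ x₁ x₂ x₃ y₁ y₂ y₃ →
    x₁ ⊑ 0ᴿ → x₂ ⊑ 0ᴿ → x₃ ⊑ 0ᴿ → y₁ ⊑ 1ᴿ → y₂ ⊑ 1ᴿ → y₃ ⊑ 1ᴿ →
    mix p x₁ y₁ +ᴿ mix p x₂ y₂ +ᴿ mix p x₃ y₃ ⊑ 3p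
  mix-sum-3 x₁ x₂ x₃ y₁ y₂ y₃ x₁⊑0 x₂⊑0 x₃⊑0 y₁⊑1 y₂⊑1 y₃⊑1 = ⊑-from-gap
    (0⊑x+y
      (0⊑x*y (0⊑y-x p⊑1) (0⊑x+y (0⊑x+y (0⊑y-x x₁⊑0) (0⊑y-x x₂⊑0)) (0⊑y-x x₃⊑0)))
      (0⊑x*y 0⊑p (0⊑x+y (0⊑x+y (0⊑y-x y₁⊑1) (0⊑y-x y₂⊑1)) (0⊑y-x y₃⊑1))))
    λ k → solve 7 (λ p x₁ x₂ x₃ y₁ y₂ y₃ →
      con (+ 3 / 1) :* p :=
        (((con 1ℚ :- p) :* x₁ :+ p :* y₁) :+ ((con 1ℚ :- p) :* x₂ :+ p :* y₂)
              :+ ((con 1ℚ :- p) :* x₃ :+ p :* y₃))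
        :+ ((con 1ℚ :- p)
              :* (((con 0ℚ :- x₁) :+ (con 0ℚ :- x₂)) :+ (con 0ℚ :- x₃))
          :+ p :* (((con 1ℚ :- y₁) :+ (con 1ℚ :- y₂)) :+ (con 1ℚ :- y₃))))
      refl (seq p k) (seq x₁ k) (seq x₂ k) (seq x₃ k)
        (seq y₁ k) (seq y₂ k) (seq y₃ k)

  -- The gap is (1 - p)(3p - 1), nonnegative since p ≥ 1/3.
  extremal-3p-1 : extremal 3p 1ᴿ ⊑ 3p
  extremal-3p-1 = ⊑-from-gap
    (0⊑x*y (0⊑const (+ 3 / 1) (ℚ.nonNegative⁻¹ (+ 3 / 1)))
      (0⊑x*y (0⊑y-x p⊑1) (0⊑y-x ⅓⊑p)))
    λ k → solve 1 (λ p →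
      con (+ 3 / 1) :* p :=
        (p :* (con (+ 3 / 1) :* p)
          :+ (con (+ 2 / 1) :* (con (+ 1 / 2) :- p)) :* con 1ℚ :+ p)
        :+ con (+ 3 / 1) :* ((con 1ℚ :- p) :* (p :- con (+ 1 / 3))))
      refl (seq p k)

  -- bound − 1 is (3p − 1)².
  extremal-bound-1 : extremal bound 1ᴿ ⊑ bound
  extremal-bound-1 = ⊑-from-gap
    (0⊑x*y (0⊑const (+ 9 / 1) (ℚ.nonNegative⁻¹ (+ 9 / 1)))
      (0⊑x*y (0⊑y-x p⊑1) (0⊑x*y (0⊑y-x ⅓⊑p) (0⊑y-x ⅓⊑p))))
    λ k → solve 1 (λ p →
      let b = con (+ 3 / 1) :* p :- (con (+ 2 / 1) :- con (+ 3 / 1) :* p)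
                :* (con (+ 3 / 1) :* p :- con 1ℚ) in
      b := (p :* b :+ (con (+ 2 / 1) :* (con (+ 1 / 2) :- p)) :* con 1ℚ :+ p)
        :+ con (+ 9 / 1) :* ((con 1ℚ :- p)
              :* ((p :- con (+ 1 / 3)) :* (p :- con (+ 1 / 3)))))
      refl (seq p k)

  -- bound − (p² + 2p) is 2(1 − 2p)².
  extremal-3p-p : extremal 3p p ⊑ bound
  extremal-3p-p = ⊑-from-gap
    (0⊑x*y (0⊑const (+ 8 / 1) (ℚ.nonNegative⁻¹ (+ 8 / 1)))
      (0⊑x*y (0⊑y-x p⊑½) (0⊑y-x p⊑½)))
    λ k → solve 1 (λ p →
      con (+ 3 / 1) :* p :- (con (+ 2 / 1) :- con (+ 3 / 1) :* p)
          :* (con (+ 3 / 1) :* p :- con 1ℚ) :=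
        (p :* (con (+ 3 / 1) :* p)
          :+ (con (+ 2 / 1) :* (con (+ 1 / 2) :- p)) :* p :+ p)
        :+ con (+ 8 / 1) :* ((con (+ 1 / 2) :- p) :* (con (+ 1 / 2) :- p)))
      refl (seq p k)

  -- From sections back to families, and the two inductions

  open Measure p 0⊑p p⊑1

  MeasureSum≤ : ℝ → (𝓕₁ 𝓕₂ 𝓕₃ : Family n) → Set
  MeasureSum≤ c 𝓕₁ 𝓕₂ 𝓕₃ = μ p 𝓕₁ +ᴿ μ p 𝓕₂ +ᴿ μ p 𝓕₃ ⊑ c

  via-mix : ∀ c (𝓕₁ 𝓕₂ 𝓕₃ : Family (suc n)) →
    mix p (μ p (𝓕₁ ⁰)) (μ p (𝓕₁ ⁺)) +ᴿ mix p (μ p (𝓕₂ ⁰)) (μ p (𝓕₂ ⁺))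
      +ᴿ mix p (μ p (𝓕₃ ⁰)) (μ p (𝓕₃ ⁺)) ⊑ c →
    MeasureSum≤ c 𝓕₁ 𝓕₂ 𝓕₃
  via-mix c 𝓕₁ 𝓕₂ 𝓕₃ = ⊑-trans
    (+ᴿ-mono₃ (μ p 𝓕₁) (μ p 𝓕₂) (μ p 𝓕₃)
      (mix p (μ p (𝓕₁ ⁰)) (μ p (𝓕₁ ⁺)))
      (mix p (μ p (𝓕₂ ⁰)) (μ p (𝓕₂ ⁺)))
      (mix p (μ p (𝓕₃ ⁰)) (μ p (𝓕₃ ⁺)))
      (μ⊑mix 𝓕₁) (μ⊑mix 𝓕₂) (μ⊑mix 𝓕₃))

  no-vacant-section : ∀ c (𝓕₁ 𝓕₂ 𝓕₃ : Family (suc n)) →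
    MeasureSum≤ c (𝓕₁ ⁰) (𝓕₂ ⁺) (𝓕₃ ⁺) →
    MeasureSum≤ c (𝓕₁ ⁺) (𝓕₂ ⁰) (𝓕₃ ⁺) →
    MeasureSum≤ c (𝓕₁ ⁺) (𝓕₂ ⁺) (𝓕₃ ⁰) →
    MeasureSum≤ c 𝓕₁ 𝓕₂ 𝓕₃
  no-vacant-section c 𝓕₁ 𝓕₂ 𝓕₃ h₁ h₂ h₃ = via-mix c 𝓕₁ 𝓕₂ 𝓕₃
    (mix-sum-0 c (μ p (𝓕₁ ⁰)) (μ p (𝓕₂ ⁰)) (μ p (𝓕₃ ⁰))
      (μ p (𝓕₁ ⁺)) (μ p (𝓕₂ ⁺)) (μ p (𝓕₃ ⁺))
      (μ⁰⊑μ⁺ 𝓕₁) (μ⁰⊑μ⁺ 𝓕₂) (μ⁰⊑μ⁺ 𝓕₃) h₁ h₂ h₃)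

  one-vacant-section : ∀ c (𝓕₁ 𝓕₂ 𝓕₃ : Family (suc n)) → Vacant (𝓕₁ ⁰) →
    MeasureSum≤ c (𝓕₁ ⁺) (𝓕₂ ⁰) (𝓕₃ ⁺) →
    MeasureSum≤ c (𝓕₁ ⁺) (𝓕₂ ⁺) (𝓕₃ ⁰) →
    MeasureSum≤ c 𝓕₁ 𝓕₂ 𝓕₃
  one-vacant-section c 𝓕₁ 𝓕₂ 𝓕₃ v₁ h₂ h₃ = via-mix c 𝓕₁ 𝓕₂ 𝓕₃
    (mix-sum-1 c (μ p (𝓕₁ ⁰)) (μ p (𝓕₂ ⁰)) (μ p (𝓕₃ ⁰))
      (μ p (𝓕₁ ⁺)) (μ p (𝓕₂ ⁺)) (μ p (𝓕₃ ⁺))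
      (μ-vacant (𝓕₁ ⁰) v₁) (0⊑μ (𝓕₁ ⁺)) (μ⁰⊑μ⁺ 𝓕₂) (μ⁰⊑μ⁺ 𝓕₃) h₂ h₃)

  two-vacant-sections : ∀ c m (𝓕₁ 𝓕₂ 𝓕₃ : Family (suc n)) →
    Vacant (𝓕₁ ⁰) → Vacant (𝓕₂ ⁰) → μ p (𝓕₃ ⁰) ⊑ m →
    MeasureSum≤ c (𝓕₁ ⁺) (𝓕₂ ⁺) (𝓕₃ ⁰) →
    MeasureSum≤ (extremal c m) 𝓕₁ 𝓕₂ 𝓕₃
  two-vacant-sections c m 𝓕₁ 𝓕₂ 𝓕₃ v₁ v₂ h h₃ = via-mix (extremal c m) 𝓕₁ 𝓕₂ 𝓕₃
    (mix-sum-2 c m (μ p (𝓕₁ ⁰)) (μ p (𝓕₂ ⁰)) (μ p (𝓕₃ ⁰))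
      (μ p (𝓕₁ ⁺)) (μ p (𝓕₂ ⁺)) (μ p (𝓕₃ ⁺))
      (μ-vacant (𝓕₁ ⁰) v₁) (μ-vacant (𝓕₂ ⁰) v₂) h (μ⊑1 (𝓕₃ ⁺)) h₃)

  all-vacant-sections : ∀ (𝓕₁ 𝓕₂ 𝓕₃ : Family (suc n)) →
    Vacant (𝓕₁ ⁰) → Vacant (𝓕₂ ⁰) → Vacant (𝓕₃ ⁰) → MeasureSum≤ 3p 𝓕₁ 𝓕₂ 𝓕₃
  all-vacant-sections 𝓕₁ 𝓕₂ 𝓕₃ v₁ v₂ v₃ = via-mix 3p 𝓕₁ 𝓕₂ 𝓕₃
    (mix-sum-3 (μ p (𝓕₁ ⁰)) (μ p (𝓕₂ ⁰)) (μ p (𝓕₃ ⁰))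
      (μ p (𝓕₁ ⁺)) (μ p (𝓕₂ ⁺)) (μ p (𝓕₃ ⁺))
      (μ-vacant (𝓕₁ ⁰) v₁) (μ-vacant (𝓕₂ ⁰) v₂) (μ-vacant (𝓕₃ ⁰) v₃)
      (μ⊑1 (𝓕₁ ⁺)) (μ⊑1 (𝓕₂ ⁺)) (μ⊑1 (𝓕₃ ⁺)))

  sum-swap₁₂ : ∀ c (𝓕₁ 𝓕₂ 𝓕₃ : Family n) →
    MeasureSum≤ c 𝓕₁ 𝓕₂ 𝓕₃ → MeasureSum≤ c 𝓕₂ 𝓕₁ 𝓕₃
  sum-swap₁₂ c 𝓕₁ 𝓕₂ 𝓕₃ = +ᴿ-swap₁₂ (μ p 𝓕₁) (μ p 𝓕₂) (μ p 𝓕₃) c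

  sum-swap₂₃ : ∀ c (𝓕₁ 𝓕₂ 𝓕₃ : Family n) →
    MeasureSum≤ c 𝓕₁ 𝓕₂ 𝓕₃ → MeasureSum≤ c 𝓕₁ 𝓕₃ 𝓕₂
  sum-swap₂₃ c 𝓕₁ 𝓕₂ 𝓕₃ = +ᴿ-swap₂₃ (μ p 𝓕₁) (μ p 𝓕₂) (μ p 𝓕₃) c

  sum⊑3p : ∀ {n} (𝓕₁ 𝓕₂ 𝓕₃ : Family n) →
    NonemptyCrossIntersecting₃ 𝓕₁ 𝓕₂ 𝓕₃ → MeasureSum≤ 3p 𝓕₁ 𝓕₂ 𝓕₃
  sum⊑3p {zero} 𝓕₁ 𝓕₂ 𝓕₃ cross = ⊥-elim (cross-zero 𝓕₁ 𝓕₂ 𝓕₃ cross)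
  sum⊑3p {suc n} 𝓕₁ 𝓕₂ 𝓕₃ cross = conclude 𝓕₁ 𝓕₂ 𝓕₃ cross
    (up-to-permutation {A = Family (suc n)} (vacant? ∘ _⁰) Goal swap-12 swap-23
      none one two 𝓕₁ 𝓕₂ 𝓕₃)
    where
    -- The hypothesis belongs to `Goal`, so that a transposition of the families reorders it
    -- together with the sum.
    Goal : (𝓕₁ 𝓕₂ 𝓕₃ : Family (suc n)) → Set
    Goal 𝓕₁ 𝓕₂ 𝓕₃ =
      NonemptyCrossIntersecting₃ 𝓕₁ 𝓕₂ 𝓕₃ → MeasureSum≤ 3p 𝓕₁ 𝓕₂ 𝓕₃

    swap-12 : ∀ 𝓕₁ 𝓕₂ 𝓕₃ → Goal 𝓕₁ 𝓕₂ 𝓕₃ → Goal 𝓕₂ 𝓕₁ 𝓕₃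
    swap-12 𝓕₁ 𝓕₂ 𝓕₃ h cross =
      sum-swap₁₂ 3p 𝓕₁ 𝓕₂ 𝓕₃ (h (swap₁₂ 𝓕₂ 𝓕₁ 𝓕₃ cross))

    swap-23 : ∀ 𝓕₁ 𝓕₂ 𝓕₃ → Goal 𝓕₁ 𝓕₂ 𝓕₃ → Goal 𝓕₁ 𝓕₃ 𝓕₂
    swap-23 𝓕₁ 𝓕₂ 𝓕₃ h cross =
      sum-swap₂₃ 3p 𝓕₁ 𝓕₂ 𝓕₃ (h (swap₂₃ 𝓕₁ 𝓕₃ 𝓕₂ cross))

    conclude : ∀ (𝓕₁ 𝓕₂ 𝓕₃ : Family (suc n)) →
      NonemptyCrossIntersecting₃ 𝓕₁ 𝓕₂ 𝓕₃ →
      Goal 𝓕₁ 𝓕₂ 𝓕₃ ⊎ (Vacant (𝓕₁ ⁰) × Vacant (𝓕₂ ⁰) × Vacant (𝓕₃ ⁰)) →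
      MeasureSum≤ 3p 𝓕₁ 𝓕₂ 𝓕₃
    conclude _ _ _ cross (inj₁ h) = h cross
    conclude 𝓕₁ 𝓕₂ 𝓕₃ _ (inj₂ (v₁ , v₂ , v₃)) =
      all-vacant-sections 𝓕₁ 𝓕₂ 𝓕₃ v₁ v₂ v₃

    none : ∀ (𝓕₁ 𝓕₂ 𝓕₃ : Family (suc n)) →
      NonemptyFamily (𝓕₁ ⁰) → NonemptyFamily (𝓕₂ ⁰) → NonemptyFamily (𝓕₃ ⁰) →
      NonemptyCrossIntersecting₃ 𝓕₁ 𝓕₂ 𝓕₃ → MeasureSum≤ 3p 𝓕₁ 𝓕₂ 𝓕₃
    none 𝓕₁ 𝓕₂ 𝓕₃ ne₁ ne₂ ne₃ cross = no-vacant-section 3p 𝓕₁ 𝓕₂ 𝓕₃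
      (sum⊑3p (𝓕₁ ⁰) (𝓕₂ ⁺) (𝓕₃ ⁺) (cross-section₁ 𝓕₁ 𝓕₂ 𝓕₃ cross ne₁))
      (sum⊑3p (𝓕₁ ⁺) (𝓕₂ ⁰) (𝓕₃ ⁺) (cross-section₂ 𝓕₁ 𝓕₂ 𝓕₃ cross ne₂))
      (sum⊑3p (𝓕₁ ⁺) (𝓕₂ ⁺) (𝓕₃ ⁰) (cross-section₃ 𝓕₁ 𝓕₂ 𝓕₃ cross ne₃))
    one : ∀ (𝓕₁ 𝓕₂ 𝓕₃ : Family (suc n)) →
      Vacant (𝓕₁ ⁰) → NonemptyFamily (𝓕₂ ⁰) → NonemptyFamily (𝓕₃ ⁰) →
      NonemptyCrossIntersecting₃ 𝓕₁ 𝓕₂ 𝓕₃ → MeasureSum≤ 3p 𝓕₁ 𝓕₂ 𝓕₃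
    one 𝓕₁ 𝓕₂ 𝓕₃ v₁ ne₂ ne₃ cross = one-vacant-section 3p 𝓕₁ 𝓕₂ 𝓕₃ v₁
      (sum⊑3p (𝓕₁ ⁺) (𝓕₂ ⁰) (𝓕₃ ⁺) (cross-section₂ 𝓕₁ 𝓕₂ 𝓕₃ cross ne₂))
      (sum⊑3p (𝓕₁ ⁺) (𝓕₂ ⁺) (𝓕₃ ⁰) (cross-section₃ 𝓕₁ 𝓕₂ 𝓕₃ cross ne₃))
    two : ∀ (𝓕₁ 𝓕₂ 𝓕₃ : Family (suc n)) →
      Vacant (𝓕₁ ⁰) → Vacant (𝓕₂ ⁰) → NonemptyFamily (𝓕₃ ⁰) →
      NonemptyCrossIntersecting₃ 𝓕₁ 𝓕₂ 𝓕₃ → MeasureSum≤ 3p 𝓕₁ 𝓕₂ 𝓕₃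
    two 𝓕₁ 𝓕₂ 𝓕₃ v₁ v₂ ne₃ cross = ⊑-trans
      (two-vacant-sections 3p 1ᴿ 𝓕₁ 𝓕₂ 𝓕₃ v₁ v₂ (μ⊑1 (𝓕₃ ⁰))
        (sum⊑3p (𝓕₁ ⁺) (𝓕₂ ⁺) (𝓕₃ ⁰) (cross-section₃ 𝓕₁ 𝓕₂ 𝓕₃ cross ne₃)))
      extremal-3p-1

  -- Three copies of the full star at the first point have total measure 3p, so some alternative to
  -- the bound is unavoidable. Sections of families with empty common intersection may acquire a
  -- common point; hence the induction carries the alternative instead of that hypothesis.
  stars-or-sum⊑bound : ∀ {n} (𝓕₁ 𝓕₂ 𝓕₃ : Family n) →
    NonemptyCrossIntersecting₃ 𝓕₁ 𝓕₂ 𝓕₃ →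
    Shifted 𝓕₁ → Shifted 𝓕₂ → Shifted 𝓕₃ →
    MeasureSum≤ bound 𝓕₁ 𝓕₂ 𝓕₃ ⊎ (Star 𝓕₁ × Star 𝓕₂ × Star 𝓕₃)
  stars-or-sum⊑bound {zero} 𝓕₁ 𝓕₂ 𝓕₃ cross = ⊥-elim (cross-zero 𝓕₁ 𝓕₂ 𝓕₃ cross)
  stars-or-sum⊑bound {suc n} 𝓕₁ 𝓕₂ 𝓕₃ cross sh₁ sh₂ sh₃ =
    conclude 𝓕₁ 𝓕₂ 𝓕₃ (cross , sh₁ , sh₂ , sh₃)
      (up-to-permutation {A = Family (suc n)} (vacant? ∘ _⁰) Goal swap-12 swap-23
        none one two 𝓕₁ 𝓕₂ 𝓕₃)
    where
    Hypotheses Goal : (𝓕₁ 𝓕₂ 𝓕₃ : Family (suc n)) → Set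
    Hypotheses 𝓕₁ 𝓕₂ 𝓕₃ =
      NonemptyCrossIntersecting₃ 𝓕₁ 𝓕₂ 𝓕₃ × Shifted 𝓕₁ × Shifted 𝓕₂ × Shifted 𝓕₃
    Goal 𝓕₁ 𝓕₂ 𝓕₃ = Hypotheses 𝓕₁ 𝓕₂ 𝓕₃ → MeasureSum≤ bound 𝓕₁ 𝓕₂ 𝓕₃

    swap-12 : ∀ 𝓕₁ 𝓕₂ 𝓕₃ → Goal 𝓕₁ 𝓕₂ 𝓕₃ → Goal 𝓕₂ 𝓕₁ 𝓕₃
    swap-12 𝓕₁ 𝓕₂ 𝓕₃ h (cross , sh₂ , sh₁ , sh₃) = sum-swap₁₂ bound 𝓕₁ 𝓕₂ 𝓕₃
      (h (swap₁₂ 𝓕₂ 𝓕₁ 𝓕₃ cross , sh₁ , sh₂ , sh₃))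

    swap-23 : ∀ 𝓕₁ 𝓕₂ 𝓕₃ → Goal 𝓕₁ 𝓕₂ 𝓕₃ → Goal 𝓕₁ 𝓕₃ 𝓕₂
    swap-23 𝓕₁ 𝓕₂ 𝓕₃ h (cross , sh₁ , sh₃ , sh₂) = sum-swap₂₃ bound 𝓕₁ 𝓕₂ 𝓕₃
      (h (swap₂₃ 𝓕₁ 𝓕₃ 𝓕₂ cross , sh₁ , sh₂ , sh₃))

    conclude : ∀ 𝓕₁ 𝓕₂ 𝓕₃ → Hypotheses 𝓕₁ 𝓕₂ 𝓕₃ →
      Goal 𝓕₁ 𝓕₂ 𝓕₃ ⊎ (Vacant (𝓕₁ ⁰) × Vacant (𝓕₂ ⁰) × Vacant (𝓕₃ ⁰)) →
      MeasureSum≤ bound 𝓕₁ 𝓕₂ 𝓕₃ ⊎ (Star 𝓕₁ × Star 𝓕₂ × Star 𝓕₃)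
    conclude _ _ _ hyps (inj₁ h) = inj₁ (h hyps)
    -- On a positive number of points, vacancy of `𝓕 ⁰` is `Star 𝓕` by definition.
    conclude _ _ _ _ (inj₂ stars) = inj₂ stars

    -- A non-empty `𝓕₂ ⁰` prevents `𝓕₂ ⁺` from being a star, which leaves the bound. `section₂` and
    -- `section₃` use `𝓕₃ ⁺` and `𝓕₂ ⁺` in the same way.
    section₁ : ∀ 𝓕₁ 𝓕₂ 𝓕₃ → Hypotheses 𝓕₁ 𝓕₂ 𝓕₃ →
      NonemptyFamily (𝓕₁ ⁰) → NonemptyFamily (𝓕₂ ⁰) →
      MeasureSum≤ bound (𝓕₁ ⁰) (𝓕₂ ⁺) (𝓕₃ ⁺)
    section₁ 𝓕₁ 𝓕₂ 𝓕₃ (cross , sh₁ , sh₂ , sh₃) ne₁ ne₂ =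
      [ id , (λ (_ , star , _) → ⊥-elim (¬star-⁺ 𝓕₂ sh₂ ne₂ star)) ]
        (stars-or-sum⊑bound (𝓕₁ ⁰) (𝓕₂ ⁺) (𝓕₃ ⁺)
          (cross-section₁ 𝓕₁ 𝓕₂ 𝓕₃ cross ne₁)
          (shifted-⁰ 𝓕₁ sh₁) (shifted-⁺ 𝓕₂ sh₂) (shifted-⁺ 𝓕₃ sh₃))

    section₂ : ∀ 𝓕₁ 𝓕₂ 𝓕₃ → Hypotheses 𝓕₁ 𝓕₂ 𝓕₃ →
      NonemptyFamily (𝓕₂ ⁰) → NonemptyFamily (𝓕₃ ⁰) →
      MeasureSum≤ bound (𝓕₁ ⁺) (𝓕₂ ⁰) (𝓕₃ ⁺)
    section₂ 𝓕₁ 𝓕₂ 𝓕₃ (cross , sh₁ , sh₂ , sh₃) ne₂ ne₃ =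
      [ id , (λ (_ , _ , star) → ⊥-elim (¬star-⁺ 𝓕₃ sh₃ ne₃ star)) ]
        (stars-or-sum⊑bound (𝓕₁ ⁺) (𝓕₂ ⁰) (𝓕₃ ⁺)
          (cross-section₂ 𝓕₁ 𝓕₂ 𝓕₃ cross ne₂)
          (shifted-⁺ 𝓕₁ sh₁) (shifted-⁰ 𝓕₂ sh₂) (shifted-⁺ 𝓕₃ sh₃))

    -- Both alternatives are kept for `two`: there `𝓕₁ ⁰` and `𝓕₂ ⁰` are vacant, and stars can
    -- occur.
    dichotomy₃ : ∀ 𝓕₁ 𝓕₂ 𝓕₃ → Hypotheses 𝓕₁ 𝓕₂ 𝓕₃ → NonemptyFamily (𝓕₃ ⁰) →
      MeasureSum≤ bound (𝓕₁ ⁺) (𝓕₂ ⁺) (𝓕₃ ⁰) ⊎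
      (Star (𝓕₁ ⁺) × Star (𝓕₂ ⁺) × Star (𝓕₃ ⁰))
    dichotomy₃ 𝓕₁ 𝓕₂ 𝓕₃ (cross , sh₁ , sh₂ , sh₃) ne₃ =
      stars-or-sum⊑bound (𝓕₁ ⁺) (𝓕₂ ⁺) (𝓕₃ ⁰)
        (cross-section₃ 𝓕₁ 𝓕₂ 𝓕₃ cross ne₃)
        (shifted-⁺ 𝓕₁ sh₁) (shifted-⁺ 𝓕₂ sh₂) (shifted-⁰ 𝓕₃ sh₃)

    section₃ : ∀ 𝓕₁ 𝓕₂ 𝓕₃ → Hypotheses 𝓕₁ 𝓕₂ 𝓕₃ →
      NonemptyFamily (𝓕₂ ⁰) → NonemptyFamily (𝓕₃ ⁰) →
      MeasureSum≤ bound (𝓕₁ ⁺) (𝓕₂ ⁺) (𝓕₃ ⁰)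
    section₃ 𝓕₁ 𝓕₂ 𝓕₃ hyps@(_ , _ , sh₂ , _) ne₂ ne₃ =
      [ id , (λ (_ , star , _) → ⊥-elim (¬star-⁺ 𝓕₂ sh₂ ne₂ star)) ]
        (dichotomy₃ 𝓕₁ 𝓕₂ 𝓕₃ hyps ne₃)

    none : ∀ 𝓕₁ 𝓕₂ 𝓕₃ →
      NonemptyFamily (𝓕₁ ⁰) → NonemptyFamily (𝓕₂ ⁰) → NonemptyFamily (𝓕₃ ⁰) →
      Hypotheses 𝓕₁ 𝓕₂ 𝓕₃ → MeasureSum≤ bound 𝓕₁ 𝓕₂ 𝓕₃
    none 𝓕₁ 𝓕₂ 𝓕₃ ne₁ ne₂ ne₃ hyps = no-vacant-section bound 𝓕₁ 𝓕₂ 𝓕₃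
      (section₁ 𝓕₁ 𝓕₂ 𝓕₃ hyps ne₁ ne₂)
      (section₂ 𝓕₁ 𝓕₂ 𝓕₃ hyps ne₂ ne₃)
      (section₃ 𝓕₁ 𝓕₂ 𝓕₃ hyps ne₂ ne₃)

    one : ∀ 𝓕₁ 𝓕₂ 𝓕₃ →
      Vacant (𝓕₁ ⁰) → NonemptyFamily (𝓕₂ ⁰) → NonemptyFamily (𝓕₃ ⁰) →
      Hypotheses 𝓕₁ 𝓕₂ 𝓕₃ → MeasureSum≤ bound 𝓕₁ 𝓕₂ 𝓕₃
    one 𝓕₁ 𝓕₂ 𝓕₃ v₁ ne₂ ne₃ hyps = one-vacant-section bound 𝓕₁ 𝓕₂ 𝓕₃ v₁
      (section₂ 𝓕₁ 𝓕₂ 𝓕₃ hyps ne₂ ne₃)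
      (section₃ 𝓕₁ 𝓕₂ 𝓕₃ hyps ne₂ ne₃)

    two : ∀ 𝓕₁ 𝓕₂ 𝓕₃ →
      Vacant (𝓕₁ ⁰) → Vacant (𝓕₂ ⁰) → NonemptyFamily (𝓕₃ ⁰) →
      Hypotheses 𝓕₁ 𝓕₂ 𝓕₃ → MeasureSum≤ bound 𝓕₁ 𝓕₂ 𝓕₃
    two 𝓕₁ 𝓕₂ 𝓕₃ v₁ v₂ ne₃ hyps@(cross , _) = [ generic , starred ]
      (dichotomy₃ 𝓕₁ 𝓕₂ 𝓕₃ hyps ne₃)
      where
      generic : MeasureSum≤ bound (𝓕₁ ⁺) (𝓕₂ ⁺) (𝓕₃ ⁰) →
        MeasureSum≤ bound 𝓕₁ 𝓕₂ 𝓕₃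
      generic h = ⊑-trans
        (two-vacant-sections bound 1ᴿ 𝓕₁ 𝓕₂ 𝓕₃ v₁ v₂ (μ⊑1 (𝓕₃ ⁰)) h)
        extremal-bound-1
      -- Only the weaker value c = 3p from `sum⊑3p` is at hand; the improvement from m = 1 to m = p
      -- makes up for it.
      starred : Star (𝓕₁ ⁺) × Star (𝓕₂ ⁺) × Star (𝓕₃ ⁰) →
        MeasureSum≤ bound 𝓕₁ 𝓕₂ 𝓕₃
      starred (_ , _ , star) = ⊑-trans
        (two-vacant-sections 3p p 𝓕₁ 𝓕₂ 𝓕₃ v₁ v₂ (μ-star (𝓕₃ ⁰) star)
          (sum⊑3p (𝓕₁ ⁺) (𝓕₂ ⁺) (𝓕₃ ⁰) (cross-section₃ 𝓕₁ 𝓕₂ 𝓕₃ cross ne₃)))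
        extremal-3p-p

-- Stars and the common intersection

zero∈⋂ : ∀ {Fs : List (Subset (suc n))} → All (zero ∈_) Fs → zero ∈ ⋂ Fs
zero∈⋂ [] = ∈⊤
zero∈⋂ (0∈F ∷ 0∈Fs) = x∈p∩q⁺ (0∈F , zero∈⋂ 0∈Fs)

star⇒zero∈ : ∀ (𝓕 : Family (suc n)) → Star 𝓕 → ∀ F → F ∈ᶠ 𝓕 → zero ∈ F
star⇒zero∈ 𝓕 star (outside Vec.∷ F) F∈ = ⊥-elim (star F F∈)
star⇒zero∈ 𝓕 star (inside Vec.∷ F) F∈ = Vec.here

⋂ᶠ-star≢⊥ : ∀ (𝓕 : Family (suc n)) → Star 𝓕 → ¬ (⋂ᶠ 𝓕 ≡ ⊥)
⋂ᶠ-star≢⊥ {n} 𝓕 star eq = ∉⊥ (subst (zero ∈_) eq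
  (zero∈⋂ (All.map (star⇒zero∈ 𝓕 star _) (all-filter (T? ∘ 𝓕) (allSubsets (suc n))))))

star-∪ᶠ : ∀ (𝓕 𝓖 : Family n) → Star 𝓕 → Star 𝓖 → Star (𝓕 ∪ᶠ 𝓖)
star-∪ᶠ {suc n} 𝓕 𝓖 s t G G∈ = [ s G , t G ] (∈-∪ᶠ⁻ (𝓕 ⁰) (𝓖 ⁰) G∈)

theorem7 : (n : ℕ) .{{_ : NonZero n}} (p : ℝ) →
    fromℚ (+ 1 / 3) ≤ᴿ p → p ≤ᴿ fromℚ (+ 1 / 2) →
    (𝓕₁ 𝓕₂ 𝓕₃ : Family n) →
    NonemptyCrossIntersecting₃ 𝓕₁ 𝓕₂ 𝓕₃ →
    (μ p 𝓕₁ +ᴿ μ p 𝓕₂ +ᴿ μ p 𝓕₃ ≤ᴿ fromℚ (+ 3 / 1) *ᴿ p)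
    ×
    (fromℚ (+ 1 / 3) <ᴿ p →
    Shifted 𝓕₁ → Shifted 𝓕₂ → Shifted 𝓕₃ →
    ⋂ᶠ (𝓕₁ ∪ᶠ 𝓕₂ ∪ᶠ 𝓕₃) ≡ ⊥ →
    μ p 𝓕₁ +ᴿ μ p 𝓕₂ +ᴿ μ p 𝓕₃ ≤ᴿ fromℚ (+ 3 / 1) *ᴿ p -ᴿ ε p)
theorem7 (suc n) p ⅓≤p p≤½ 𝓕₁ 𝓕₂ 𝓕₃ cross =
  ⊑⇒≤ (sum⊑3p 𝓕₁ 𝓕₂ 𝓕₃ cross) , λ _ sh₁ sh₂ sh₃ ⋂≡⊥ →
    [ ⊑⇒≤
    -- If all three families are stars, so is their union, and the first point lies in the
    -- intersection assumed empty.
    , (λ (s₁ , s₂ , s₃) → ⊥-elim (⋂ᶠ-star≢⊥ (𝓕₁ ∪ᶠ 𝓕₂ ∪ᶠ 𝓕₃)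
        (star-∪ᶠ (𝓕₁ ∪ᶠ 𝓕₂) 𝓕₃ (star-∪ᶠ 𝓕₁ 𝓕₂ s₁ s₂) s₃) ⋂≡⊥))
    ] (stars-or-sum⊑bound 𝓕₁ 𝓕₂ 𝓕₃ cross sh₁ sh₂ sh₃)
  where open Range p ⟨ ⅓≤p ⟩ ⟨ p≤½ ⟩
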